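{- For every nonnegative integer $k$, \[ \sum_{C\in\Delta^+_k}\mathrm{wt}_q(C)=\sum_{i=-k}^{k}(-q)^{i^2}, \] where $\Delta^+_k$ is the set of $\delta_k^+$-configurations defined below. Equivalently, for $k\ge1$, $\sum_{C\in\Delta^+_k}\mathrm{wt}_q(C)=\sum_{C\in\Delta^+_{k-1}}\mathrm{wt}_q(C)+2(-q)^{k^2}$.
   Context: Partitions are identified with their Ferrers diagrams (English convention: row $i$ from the top has $\lambda_i$ cells, left-justified). $\delta_k$ denotes the staircase partition $(k,k-1,\dots,1)$ (and $\delta_0=\emptyset$). For partitions $\lambda\subset\mu$, $\mu/\lambda$ is the set of cells of $\mu$ not in $\lambda$. A $\delta_k^+$-configuration is a pair $(\lambda,A)$ where $\lambda$ is a partition with $\lambda\subset\delta_{k-1}$ and $A$ is a set of arrows, each arrow occupying all the cells of one whole row or of one whole column of $\delta_k/\lambda$ (horizontal or vertical arrow; each row or column of $\delta_k/\lambda$ carries at most one arrow), such that no outer corner of $\delta_k/\lambda$ is occupied by two arrows; an outer corner is a cell $c\in\delta_k/\lambda$ such that $\lambda\cup\{c\}$ is a partition. The length of an arrow is the number of cells it occupies, and $\|A\|$ is the sum of the arrow lengths. $\Delta^+_k$ is the set of $\delta_k^+$-configurations, and the $q$-weight of $C=(\lambda,A)$ is $\mathrm{wt}_q(C)=(-1)^{|A|}q^{2|\lambda|+\|A\|}$, where $|\lambda|$ is the number of cells of $\lambda$ and $|A|$ the number of arrows. -}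

module Defs where

open import Data.Bool using (Bool; true; false; _∧_; _∨_; not; if_then_else_)
open import Data.Nat using (ℕ; zero; suc; _+_; _*_; _∸_; _≤ᵇ_; _≡ᵇ_)
open import Data.Integer as ℤ using (ℤ; +_; -_)
open import Data.List using (List; []; _∷_; _++_; map; concatMap; filterᵇ; length; upTo; foldr)
open import Data.Product using (_×_; _,_; proj₁; proj₂)

-- Polynomials in q with integer coefficients, as finite sums of
-- monomials  c · q^e  (pairs (c , e)); two polynomials are equal iff
-- all their coefficients agree.

Poly : Set
Poly = List (ℤ × ℕ)

coeff : Poly → ℕ → ℤ
coeff [] n = + 0
coeff ((c , e) ∷ p) n = (if e ≡ᵇ n then c else + 0) ℤ.+ coeff p n

_≈ₚ_ : Poly → Poly → Set
p ≈ₚ r = ∀ n → coeff p n ≡ coeff r n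
  where open import Relation.Binary.PropositionalEquality using (_≡_)

negqPow : ℕ → ℤ × ℕ
negqPow m = ((- (+ 1)) ℤ.^ m , m)

sum : List ℕ → ℕ
sum = foldr _+_ 0

all : {A : Set} → (A → Bool) → List A → Bool
all p = foldr (λ x b → p x ∧ b) true

range1 : ℕ → List ℕ
range1 k = map suc (upTo k)

count : {A : Set} → (A → Bool) → List A → ℕ
count p xs = length (filterᵇ p xs)

vecs : ℕ → ℕ → List (List ℕ)
vecs m zero = [] ∷ []
vecs m (suc n) = concatMap (λ x → map (x ∷_) (vecs m n)) (upTo (suc m))

sublists : {A : Set} → List A → List (List A)
sublists [] = [] ∷ []
sublists (x ∷ xs) = sublists xs ++ map (x ∷_) (sublists xs)

-- Partitions and cells (rows and columns indexed from 1, English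
-- convention).  A partition contained in δ_{k-1} is stored as the list
-- (λ_1, …, λ_k) of its first k parts (λ_k = 0 necessarily).

Cell : Set
Cell = ℕ × ℕ      -- (row i , column j)

-- λ_i (0 outside rows 1..length)
part : List ℕ → ℕ → ℕ
part [] i = 0
part (x ∷ xs) zero = 0
part (x ∷ xs) (suc zero) = x
part (x ∷ xs) (suc (suc i)) = part xs (suc i)

size : List ℕ → ℕ
size = sum

inPart : List ℕ → Cell → Bool
inPart la (i , j) = (1 ≤ᵇ i) ∧ (1 ≤ᵇ j) ∧ (j ≤ᵇ part la i)

-- cell (i,j) ∈ δ_k  (row i has k+1-i cells)
inDelta : ℕ → Cell → Bool
inDelta k (i , j) = (1 ≤ᵇ i) ∧ (1 ≤ᵇ j) ∧ ((i + j) ≤ᵇ suc k)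

inSkew : ℕ → List ℕ → Cell → Bool
inSkew k la c = inDelta k c ∧ not (inPart la c)

-- the box [1..k]×[1..k], which contains every cell of δ_k
box : ℕ → List Cell
box k = concatMap (λ i → map (λ j → (i , j)) (range1 k)) (range1 k)

-- a (finite) set of cells S ⊆ box k, given by its indicator, is a
-- Ferrers diagram: closed under moving up and moving left
isDiagram : ℕ → (Cell → Bool) → Bool
isDiagram k S = all ok (box k)
  where
  ok : Cell → Bool
  ok (i , j) = not (S (i , j))
               ∨ (((i ≡ᵇ 1) ∨ S (i ∸ 1 , j)) ∧ ((j ≡ᵇ 1) ∨ S (i , j ∸ 1)))

partInDeltaPrev : ℕ → List ℕ → Bool
partInDeltaPrev k la =
  all (λ i → part la (suc i) ≤ᵇ part la i) (range1 k)
  ∧ all (λ i → (part la i + i) ≤ᵇ k) (range1 k)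

partitionsIn : ℕ → List (List ℕ)
partitionsIn k = filterᵇ (partInDeltaPrev k) (vecs k k)

outerCorner : ℕ → List ℕ → Cell → Bool
outerCorner k la c =
  inSkew k la c ∧ isDiagram k (λ d → inPart la d ∨ ((proj₁ d ≡ᵇ proj₁ c) ∧ (proj₂ d ≡ᵇ proj₂ c)))

data Dir : Set where
  horiz vert : Dir

-- an arrow: horiz i occupies the whole row i of δ_k/λ,
--           vert j  occupies the whole column j of δ_k/λ
Arrow : Set
Arrow = Dir × ℕ

occupies : ℕ → List ℕ → Arrow → Cell → Bool
occupies k la (horiz , r) (i , j) = (i ≡ᵇ r) ∧ inSkew k la (i , j)
occupies k la (vert  , r) (i , j) = (j ≡ᵇ r) ∧ inSkew k la (i , j)

arrowLength : ℕ → List ℕ → Arrow → ℕ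
arrowLength k la a = count (occupies k la a) (box k)

totalLength : ℕ → List ℕ → List Arrow → ℕ
totalLength k la as = sum (map (arrowLength k la) as)

-- all possible arrow positions: rows 1..k and columns 1..k
-- (each listed once, so a sublist carries at most one arrow per row/column)
arrowSlots : ℕ → List Arrow
arrowSlots k = map (horiz ,_) (range1 k) ++ map (vert ,_) (range1 k)

validArrows : ℕ → List ℕ → List Arrow → Bool
validArrows k la as =
  all (λ a → 1 ≤ᵇ arrowLength k la a) as
  ∧ all (λ c → not (outerCorner k la c) ∨ (count (λ a → occupies k la a c) as ≤ᵇ 1)) (box k)

Config : Set
Config = List ℕ × List Arrow

-- Δ^+_k, enumerated without repetition
DeltaPlus : ℕ → List Config
DeltaPlus k =
  concatMap (λ la → map (la ,_) (filterᵇ (validArrows k la) (sublists (arrowSlots k))))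
            (partitionsIn k)

wt : ℕ → Config → ℤ × ℕ
wt k (la , as) = ((- (+ 1)) ℤ.^ length as , 2 * size la + totalLength k la as)

lhs : ℕ → Poly
lhs k = map (wt k) (DeltaPlus k)

rhs : ℕ → Poly
rhs k = map (λ i → negqPow (ℤ.∣ i ∣ * ℤ.∣ i ∣)) (map (λ n → (+ n) ℤ.- (+ k)) (upTo (suc (2 * k))))

{-# OPTIONS --safe #-}

-- An outer corner has equally long row and column, so for fixed λ the arrows
-- contribute a product: 1 - q^ℓ for every row or column of length ℓ that misses
-- the outer corners, and 1 - 2q^d for every corner whose row and column have
-- length d.  Reading the boundary of λ as a lattice path turns the sum over λ
-- into the weighted count `walks h r` of paths with h + r up steps and r right
-- steps, governed by the three-term recurrence obtained from
--   q^{2r}(1 - 2q^d) = q^{2r}(1 - q^d)² - q^{2(r + d)}.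
-- The key point is that `walks` satisfies a second, Pascal-like recurrence
--   walks (h+1) r = (1 - q^{h+1+2r}) walks h r + q^{h+1} walks (h+1) (r-1),
-- and the two recurrences together force
--   walks 0 (k+1) - walks 0 k = - q^{2k+1} (walks 0 k - walks 0 (k-1)).
-- All identities are checked in ℤ, at integer values of q.
module Submission where

open import Defs
open import Data.Nat using (ℕ)
open import Data.Bool using (Bool; true; false; if_then_else_; _∧_; _∨_; not; T)
open import Data.List using (List; []; _∷_; _++_; map; concatMap; filterᵇ; upTo; length)
open import Data.List.Properties using (upTo-∷ʳ; map-upTo; map-++; ++-assoc)
open import Data.List.Membership.Propositional.Properties using (∈-upTo⁻)
open import Data.List.Relation.Unary.All as All using (All; []; _∷_)
import Data.List.Relation.Unary.All.Properties as All
import Data.List.Relation.Binary.Permutation.Propositional as ↭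
open import Data.List.Relation.Binary.Permutation.Propositional using (_↭_; ↭-sym; ↭-reflexive)
open import Data.List.Relation.Binary.Permutation.Propositional.Properties using (All-resp-↭; ++-comm; ++⁺ˡ)
open import Data.Product using (_×_; _,_; proj₁; proj₂)
open import Function using (_∘_)
open import Relation.Nullary using (¬_; contradiction)
open import Relation.Nullary.Reflects
open import Relation.Binary.PropositionalEquality

-- Shapes, arrows and corners

-- The three-term recurrence reaches `walks 0 (suc r)` through `walks 1 r`, which in turn involves
-- `walks 2`, and so on: the values `walks 0 k` that the theorem is about satisfy no visible
-- recurrence among themselves. The Pascal-like relation closes this gap. It is not read off from
-- configurations but derived algebraically from the three-term recurrence; each inductive step is a
-- linear combination, with explicit polynomial multipliers, of relations already known.
--
-- The parameter h is the slack that makes an induction over rows possible: once the top row is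
-- removed, the remaining rows lie beneath a row of arbitrary length. The same device at the very
-- top, a virtual row 0 with k cells, assigns every column of δ_k to exactly one row, namely the
-- first row of λ that fails to reach that column. Each row together with its columns is a block,
-- and the two arrows that can collide at a corner always belong to the same block, so the sum over
-- arrow sets factors.

module Configurations where

  open import Algebra.Properties.CommutativeSemigroup using (interchange)
  open import Data.Bool.Properties using (∧-identityʳ)
  open import Data.List using (applyUpTo)
  open import Data.List.Properties using (map-cong)
  open import Data.Nat using (zero; suc; _+_; _*_; _∸_; _≤_; _<_; _≤ᵇ_; _<ᵇ_; _≡ᵇ_; z≤n; s≤s)
  open import Data.Nat.Properties
  open import Data.Sum using (_⊎_; inj₁; inj₂)
  open import Data.Unit using (⊤)

  -- Boolean tests on lists and boxes, reflected into propositions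

  reflects-⇔ : {P Q : Set} {b : Bool} → (P → Q) → (Q → P) → Reflects P b → Reflects Q b
  reflects-⇔ f g (ofʸ p)  = ofʸ (f p)
  reflects-⇔ f g (ofⁿ ¬p) = ofⁿ (¬p ∘ g)

  reflects-true : {P : Set} {b : Bool} → Reflects P b → P → b ≡ true
  reflects-true (ofʸ _)  p = refl
  reflects-true (ofⁿ ¬p) p = contradiction p ¬p

  reflects-false : {P : Set} {b : Bool} → Reflects P b → ¬ P → b ≡ false
  reflects-false (ofʸ p) ¬p = contradiction p ¬p
  reflects-false (ofⁿ _) ¬p = refl

  ≡ᵇ-reflects-≡ : ∀ m n → Reflects (m ≡ n) (m ≡ᵇ n)
  ≡ᵇ-reflects-≡ m n = fromEquivalence (≡ᵇ⇒≡ m n) (≡⇒≡ᵇ m n)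

  all-applyUpTo-reflects : {A : Set} {P : ℕ → Set} (p : A → Bool) (f : ℕ → A) (n : ℕ) →
    (∀ i → Reflects (P i) (p (f i))) → Reflects (∀ i → i < n → P i) (all p (applyUpTo f n))
  all-applyUpTo-reflects p f zero    r = of λ _ ()
  all-applyUpTo-reflects p f (suc n) r = reflects-⇔
    (λ { (p₀ , ps) zero _ → p₀ ; (p₀ , ps) (suc i) (s≤s i<n) → ps i i<n })
    (λ ps → ps 0 (s≤s z≤n) , λ i i<n → ps (suc i) (s≤s i<n))
    (r 0 ×-reflects all-applyUpTo-reflects p (f ∘ suc) n (r ∘ suc))

  all-range1-reflects : {P : ℕ → Set} (p : ℕ → Bool) (k : ℕ) →
    (∀ i → Reflects (P i) (p (suc i))) → Reflects (∀ i → i < k → P i) (all p (range1 k))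
  all-range1-reflects {P} p k r =
    subst (λ xs → Reflects (∀ i → i < k → P i) (all p xs)) (sym (map-upTo suc k)) (all-applyUpTo-reflects p suc k r)

  all-++ : {A : Set} (p : A → Bool) (xs ys : List A) → all p (xs ++ ys) ≡ all p xs ∧ all p ys
  all-++ p []       ys = refl
  all-++ p (x ∷ xs) ys with p x
  ... | true  = all-++ p xs ys
  ... | false = refl

  all-map : {A B : Set} (p : B → Bool) (f : A → B) (xs : List A) → all p (map f xs) ≡ all (p ∘ f) xs
  all-map p f []       = refl
  all-map p f (x ∷ xs) = cong (p (f x) ∧_) (all-map p f xs)

  all-concatMap : {A B : Set} (p : B → Bool) (f : A → List B) (xs : List A) →
    all p (concatMap f xs) ≡ all (λ x → all p (f x)) xs
  all-concatMap p f []       = refl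
  all-concatMap p f (x ∷ xs) = trans (all-++ p (f x) _) (cong (all p (f x) ∧_) (all-concatMap p f xs))

  all-box-reflects : {P : ℕ → ℕ → Set} (p : Cell → Bool) (k : ℕ) →
    (∀ i j → Reflects (P i j) (p (suc i , suc j))) →
    Reflects (∀ i → i < k → ∀ j → j < k → P i j) (all p (box k))
  all-box-reflects p k r =
    subst (Reflects _) (sym (all-concatMap p (λ i → map (i ,_) (range1 k)) (range1 k)))
      (all-range1-reflects _ k λ i →
        subst (Reflects _) (sym (all-map p (suc i ,_) (range1 k))) (all-range1-reflects _ k (r i)))

  all-reflects : {A : Set} {P : A → Set} (p : A → Bool) → (∀ x → Reflects (P x) (p x)) →
    ∀ xs → Reflects (All P xs) (all p xs)
  all-reflects p r []       = of []
  all-reflects p r (x ∷ xs) = reflects-⇔ (λ (px , pxs) → px ∷ pxs) (λ { (px ∷ pxs) → px , pxs })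
    (r x ×-reflects all-reflects p r xs)

  -- Intervals of integers, and counting over them

  from : ℕ → ℕ → List ℕ
  from a zero    = []
  from a (suc n) = a ∷ from (suc a) n

  map-suc-from : ∀ a n → map suc (from a n) ≡ from (suc a) n
  map-suc-from a zero    = refl
  map-suc-from a (suc n) = cong (suc a ∷_) (map-suc-from (suc a) n)

  upTo≡from : ∀ n → upTo n ≡ from 0 n
  upTo≡from zero    = refl
  upTo≡from (suc n) = cong (0 ∷_) (trans (sym (map-upTo suc n)) (trans (cong (map suc) (upTo≡from n)) (map-suc-from 0 n)))

  range1≡from : ∀ n → range1 n ≡ from 1 n
  range1≡from n = trans (cong (map suc) (upTo≡from n)) (map-suc-from 0 n)

  from-++ : ∀ a m n → from a (m + n) ≡ from a m ++ from (a + m) n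
  from-++ a zero    n = cong (λ c → from c n) (sym (+-identityʳ a))
  from-++ a (suc m) n = cong (a ∷_) (trans (from-++ (suc a) m n) (cong (λ c → from (suc a) m ++ from c n) (sym (+-suc a m))))

  All-from : {P : ℕ → Set} (a n : ℕ) → (∀ i → a ≤ i → i < a + n → P i) → All P (from a n)
  All-from a zero    h = []
  All-from a (suc n) h = h a ≤-refl (m<m+n a (s≤s z≤n))
    ∷ All-from (suc a) n (λ i a<i i< → h i (<⇒≤ a<i) (≤-trans i< (≤-reflexive (sym (+-suc a n)))))

  indicator : Bool → ℕ
  indicator b = if b then 1 else 0

  count-∷ : {A : Set} (p : A → Bool) (x : A) (xs : List A) → count p (x ∷ xs) ≡ indicator (p x) + count p xs
  count-∷ p x xs with p x
  ... | true  = refl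
  ... | false = refl

  count-++ : {A : Set} (p : A → Bool) (xs ys : List A) → count p (xs ++ ys) ≡ count p xs + count p ys
  count-++ p []       ys = refl
  count-++ p (x ∷ xs) ys with p x
  ... | true  = cong suc (count-++ p xs ys)
  ... | false = count-++ p xs ys

  count≡sum : {A : Set} (p : A → Bool) (xs : List A) → count p xs ≡ sum (map (indicator ∘ p) xs)
  count≡sum p []       = refl
  count≡sum p (x ∷ xs) = trans (count-∷ p x xs) (cong (indicator (p x) +_) (count≡sum p xs))

  count-map : {A B : Set} (p : B → Bool) (f : A → B) (xs : List A) → count p (map f xs) ≡ count (p ∘ f) xs
  count-map p f []       = refl
  count-map p f (x ∷ xs) with p (f x)
  ... | true  = cong suc (count-map p f xs)
  ... | false = count-map p f xs

  count-concatMap : {A B : Set} (p : B → Bool) (f : A → List B) (xs : List A) →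
    count p (concatMap f xs) ≡ sum (map (λ x → count p (f x)) xs)
  count-concatMap p f []       = refl
  count-concatMap p f (x ∷ xs) = trans (count-++ p (f x) _) (cong (count p (f x) +_) (count-concatMap p f xs))

  count-box : (p : Cell → Bool) (k : ℕ) →
    count p (box k) ≡ sum (map (λ i → sum (map (λ j → indicator (p (i , j))) (range1 k))) (range1 k))
  count-box p k = trans (count-concatMap p _ (range1 k))
    (cong sum (map-cong (λ i → trans (count-map p (i ,_) (range1 k)) (count≡sum _ (range1 k))) (range1 k)))

  sum-++ : ∀ xs ys → sum (xs ++ ys) ≡ sum xs + sum ys
  sum-++ []       ys = refl
  sum-++ (x ∷ xs) ys = trans (cong (x +_) (sum-++ xs ys)) (sym (+-assoc x (sum xs) (sum ys)))

  sum-constant : (f : ℕ → ℕ) (v a n : ℕ) → (∀ i → a ≤ i → i < a + n → f i ≡ v) → sum (map f (from a n)) ≡ n * v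
  sum-constant f v a zero    h = refl
  sum-constant f v a (suc n) h = cong₂ _+_ (h a ≤-refl (m<m+n a (s≤s z≤n)))
    (sum-constant f v (suc a) n (λ i a<i i< → h i (<⇒≤ a<i) (≤-trans i< (≤-reflexive (sym (+-suc a n))))))

  -- Rows and columns of δ_k/λ are intervals, so arrow lengths come from two nested uses: one picks
  -- the line out of the box (an interval of length 1), the other counts its cells. The hypotheses
  -- are about `f (suc i)` because `range1` starts at 1 while the end points count from 0.
  sum-interval : (f : ℕ → ℕ) (v k a e : ℕ) → a ≤ e → e ≤ k →
    (∀ i → i < a → f (suc i) ≡ 0) → (∀ i → a ≤ i → i < e → f (suc i) ≡ v) → (∀ i → e ≤ i → f (suc i) ≡ 0) →
    sum (map f (range1 k)) ≡ (e ∸ a) * v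
  sum-interval f v k a e a≤e e≤k below inside above = begin
    sum (map f (range1 k))
      ≡⟨ cong (sum ∘ map f) split ⟩
    sum (map f (from 1 a ++ (from (suc a) (e ∸ a) ++ from (suc e) (k ∸ e))))
      ≡⟨ sum-map-++ (from 1 a) _ ⟩
    sum (map f (from 1 a)) + sum (map f (from (suc a) (e ∸ a) ++ from (suc e) (k ∸ e)))
      ≡⟨ cong (sum (map f (from 1 a)) +_) (sum-map-++ (from (suc a) (e ∸ a)) _) ⟩
    sum (map f (from 1 a)) + (sum (map f (from (suc a) (e ∸ a))) + sum (map f (from (suc e) (k ∸ e))))
      ≡⟨ cong₂ _+_ (sum-constant f 0 1 a λ { (suc i) _ (s≤s i<a) → below i i<a })
           (cong₂ _+_ (sum-constant f v (suc a) (e ∸ a) λ { (suc i) (s≤s a≤i) (s≤s i<) → inside i a≤i (≤-trans i< (≤-reflexive (m+[n∸m]≡n a≤e))) })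
                      (sum-constant f 0 (suc e) (k ∸ e) λ { (suc i) (s≤s e≤i) _ → above i e≤i })) ⟩
    a * 0 + ((e ∸ a) * v + (k ∸ e) * 0)
      ≡⟨ cong₂ _+_ (*-zeroʳ a) (trans (cong ((e ∸ a) * v +_) (*-zeroʳ (k ∸ e))) (+-identityʳ _)) ⟩
    (e ∸ a) * v ∎
    where
    open ≡-Reasoning
    sum-map-++ : ∀ xs ys → sum (map f (xs ++ ys)) ≡ sum (map f xs) + sum (map f ys)
    sum-map-++ xs ys = trans (cong sum (map-++ f xs ys)) (sum-++ (map f xs) (map f ys))
    split : range1 k ≡ from 1 a ++ (from (suc a) (e ∸ a) ++ from (suc e) (k ∸ e))
    split = begin
      range1 k                                                  ≡⟨ range1≡from k ⟩
      from 1 k                                                  ≡⟨ cong (from 1) (m+[n∸m]≡n (≤-trans a≤e e≤k)) ⟨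
      from 1 (a + (k ∸ a))                                      ≡⟨ from-++ 1 a (k ∸ a) ⟩
      from 1 a ++ from (suc a) (k ∸ a)                          ≡⟨ cong (λ n → from 1 a ++ from (suc a) n) lengths ⟩
      from 1 a ++ from (suc a) ((e ∸ a) + (k ∸ e))              ≡⟨ cong (from 1 a ++_) (from-++ (suc a) (e ∸ a) (k ∸ e)) ⟩
      from 1 a ++ (from (suc a) (e ∸ a) ++ from (suc (a + (e ∸ a))) (k ∸ e))
        ≡⟨ cong (λ c → from 1 a ++ (from (suc a) (e ∸ a) ++ from (suc c) (k ∸ e))) (m+[n∸m]≡n a≤e) ⟩
      from 1 a ++ (from (suc a) (e ∸ a) ++ from (suc e) (k ∸ e)) ∎
      where
      lengths : k ∸ a ≡ (e ∸ a) + (k ∸ e)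
      lengths = begin
        k ∸ a                 ≡⟨ cong (_∸ a) (m+[n∸m]≡n e≤k) ⟨
        (e + (k ∸ e)) ∸ a     ≡⟨ +-∸-comm (k ∸ e) a≤e ⟩
        (e ∸ a) + (k ∸ e)     ∎

  -- The second argument of the recursion counts the rows left. The bound on `b (suc i)` is the
  -- number of rows strictly below, which is containment in δ_{k-1} rather than in δ_k. The
  -- recursive form lets the top row be peeled off, leaving the same condition on the rest.
  chain : (ℕ → ℕ) → ℕ → ℕ → Bool
  chain b i zero    = true
  chain b i (suc m) = (b (suc i) ≤ᵇ b i) ∧ (b (suc i) ≤ᵇ m) ∧ chain b (suc i) m

  chain-shift : ∀ b i m → chain b (suc i) m ≡ chain (λ j → b (suc j)) i m
  chain-shift b i zero    = refl
  chain-shift b i (suc m) = cong (λ t → (b (2 + i) ≤ᵇ b (suc i)) ∧ (b (2 + i) ≤ᵇ m) ∧ t) (chain-shift b (suc i) m)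

  -- λ₀ = s, λ₁, λ₂, …; for s = k the virtual row 0 makes row 1 obey the same corner rule as the others.
  boundary : ℕ → List ℕ → ℕ → ℕ
  boundary s la i = part (s ∷ la) (suc i)

  Descending : ℕ → (ℕ → ℕ) → Set
  Descending k b = ∀ i → i < k → b (suc i) ≤ b i × b (suc i) + suc i ≤ k

  chain-reflects : ∀ b k → Reflects (Descending k b) (chain b 0 k)
  chain-reflects b zero    = of λ _ ()
  chain-reflects b (suc k) = reflects-⇔ to back
    (≤ᵇ-reflects-≤ (b 1) (b 0) ×-reflects ≤ᵇ-reflects-≤ (b 1) k
      ×-reflects subst (Reflects _) (sym (chain-shift b 0 k)) (chain-reflects (b ∘ suc) k))
    where
    to : b 1 ≤ b 0 × b 1 ≤ k × Descending k (b ∘ suc) → Descending (suc k) b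
    to (b₁≤b₀ , b₁≤k , rest) zero    _         = b₁≤b₀ , ≤-trans (≤-reflexive (+-comm (b 1) 1)) (s≤s b₁≤k)
    to (b₁≤b₀ , b₁≤k , rest) (suc i) (s≤s i<k) =
      proj₁ (rest i i<k) , ≤-trans (≤-reflexive (+-suc (b (2 + i)) (suc i))) (s≤s (proj₂ (rest i i<k)))
    back : Descending (suc k) b → b 1 ≤ b 0 × b 1 ≤ k × Descending k (b ∘ suc)
    back d = proj₁ (d 0 (s≤s z≤n)) , ≤-pred (≤-trans (≤-reflexive (+-comm 1 (b 1))) (proj₂ (d 0 (s≤s z≤n))))
      , λ i i<k → proj₁ (d (suc i) (s≤s i<k))
                , ≤-pred (≤-trans (≤-reflexive (sym (+-suc (b (2 + i)) (suc i)))) (proj₂ (d (suc i) (s≤s i<k))))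

  part-beyond : ∀ la i → length la ≤ i → part la (suc i) ≡ 0
  part-beyond []       i       _         = refl
  part-beyond (x ∷ la) (suc i) (s≤s l≤i) = part-beyond la i l≤i

  -- The two tests compare different pairs of rows: (1,2), ..., (k,k+1) on the left, (0,1), ...,
  -- (k-1,k) on the right. The comparison with the virtual row 0 follows from the containment bound,
  -- and row k+1 is empty because the list has length k.
  partInDeltaPrev≡chain : ∀ la k → length la ≡ k → partInDeltaPrev k la ≡ chain (boundary k la) 0 k
  partInDeltaPrev≡chain la k len = det
    (reflects-⇔ to back
      (all-range1-reflects (λ i → part la (suc i) ≤ᵇ part la i) k (λ i → ≤ᵇ-reflects-≤ (part la (2 + i)) (part la (suc i)))
       ×-reflects all-range1-reflects (λ i → (part la i + i) ≤ᵇ k) k (λ i → ≤ᵇ-reflects-≤ (part la (suc i) + suc i) k)))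
    (chain-reflects (boundary k la) k)
    where
    Bounded : Set
    Bounded = (∀ i → i < k → part la (2 + i) ≤ part la (suc i)) × (∀ i → i < k → part la (suc i) + suc i ≤ k)
    to : Bounded → Descending k (boundary k la)
    to (desc , bound) zero    i<k = ≤-trans (m≤m+n _ 1) (bound 0 i<k) , bound 0 i<k
    to (desc , bound) (suc i) i<k = desc i (<⇒≤ i<k) , bound (suc i) i<k
    back : Descending k (boundary k la) → Bounded
    back d = desc , λ i i<k → proj₂ (d i i<k)
      where
      desc : ∀ i → i < k → part la (2 + i) ≤ part la (suc i)
      desc i i<k with m≤n⇒m<n∨m≡n i<k
      ... | inj₁ 1+i<k = proj₁ (d (suc i) 1+i<k)
      ... | inj₂ 1+i≡k = ≤-trans (≤-reflexive (part-beyond la (suc i) (≤-reflexive (trans len (sym 1+i≡k))))) z≤n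

  sameArrow : Arrow → Arrow → Bool
  sameArrow (horiz , i) (horiz , j) = i ≡ᵇ j
  sameArrow (horiz , i) (vert  , j) = false
  sameArrow (vert  , i) (horiz , j) = false
  sameArrow (vert  , i) (vert  , j) = i ≡ᵇ j

  multiplicity : Arrow → List Arrow → ℕ
  multiplicity a = count (sameArrow a)

  -- The only candidate for an outer corner in row i+1 is its first cell outside λ, in column
  -- `suc (b (suc i))`; it is one exactly when the row above is strictly longer.
  rowOK : (ℕ → ℕ) → ℕ → List Arrow → Bool
  rowOK b i as = not (b (suc i) <ᵇ b i)
    ∨ (multiplicity (horiz , suc i) as + multiplicity (vert , suc (b (suc i))) as ≤ᵇ 1)

  rowsOK : (ℕ → ℕ) → ℕ → ℕ → List Arrow → Bool
  rowsOK b i zero    as = true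
  rowsOK b i (suc m) as = rowOK b i as ∧ rowsOK b (suc i) m as

  RowOK : (ℕ → ℕ) → List Arrow → ℕ → Set
  RowOK b as i = b (suc i) < b i → multiplicity (horiz , suc i) as + multiplicity (vert , suc (b (suc i))) as ≤ 1

  rowOK-reflects : ∀ b as i → Reflects (RowOK b as i) (rowOK b i as)
  rowOK-reflects b as i = <ᵇ-reflects-< (b (suc i)) (b i) →-reflects ≤ᵇ-reflects-≤ _ 1

  rowsOK-reflects : ∀ b as i m → Reflects (∀ j → i ≤ j → j < i + m → RowOK b as j) (rowsOK b i m as)
  rowsOK-reflects b as i zero    = of λ j i≤j j< → contradiction (≤-trans j< (≤-reflexive (+-identityʳ i))) (≤⇒≯ i≤j)
  rowsOK-reflects b as i (suc m) = reflects-⇔ to back (rowOK-reflects b as i ×-reflects rowsOK-reflects b as (suc i) m)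
    where
    to : RowOK b as i × (∀ j → suc i ≤ j → j < suc i + m → RowOK b as j) → ∀ j → i ≤ j → j < i + suc m → RowOK b as j
    to (ok , oks) j i≤j j< with m≤n⇒m<n∨m≡n i≤j
    ... | inj₁ i<j  = oks j i<j (≤-trans j< (≤-reflexive (+-suc i m)))
    ... | inj₂ refl = ok
    back : (∀ j → i ≤ j → j < i + suc m → RowOK b as j) → RowOK b as i × (∀ j → suc i ≤ j → j < suc i + m → RowOK b as j)
    back oks = oks i ≤-refl (m<m+n i (s≤s z≤n))
      , λ j i<j j< → oks j (<⇒≤ i<j) (≤-trans j< (≤-reflexive (sym (+-suc i m))))

  -- Rows, columns and outer corners of δ_k/λ

  module Geometry (k : ℕ) (la : List ℕ) (desc : Descending k (boundary k la)) where

    b : ℕ → ℕ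
    b = boundary k la

    b-bound : ∀ i → i ≤ k → b i + i ≤ k
    b-bound zero    _   = ≤-reflexive (+-identityʳ k)
    b-bound (suc i) i<k = proj₂ (desc i i<k)

    b-antitone : ∀ d i → d + i ≤ k → b (d + i) ≤ b i
    b-antitone zero    i _ = ≤-refl
    b-antitone (suc d) i h = ≤-trans (proj₁ (desc (d + i) h)) (b-antitone d i (<⇒≤ h))

    b-mono : ∀ {i j} → i ≤ j → j ≤ k → b j ≤ b i
    b-mono {i} {j} i≤j j≤k = subst (λ m → b m ≤ b i) (m∸n+n≡m i≤j)
      (b-antitone (j ∸ i) i (≤-trans (≤-reflexive (m∸n+n≡m i≤j)) j≤k))

    skew-reflects : ∀ i j → Reflects (i + suc j ≤ k × b (suc i) ≤ j) (inSkew k la (suc i , suc j))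
    skew-reflects i j = reflects-⇔ (λ (h , ¬p) → ≤-pred h , ≮⇒≥ ¬p) (λ (h , p) → s≤s h , ≤⇒≯ p)
      (≤ᵇ-reflects-≤ (suc i + suc j) (suc k) ×-reflects ¬-reflects (≤ᵇ-reflects-≤ (suc j) (b (suc i))))

    horiz-length : ∀ i m → i + suc m ≡ k → arrowLength k la (horiz , suc i) ≡ suc m ∸ b (suc i)
    horiz-length i m eq = trans (count-box (occupies k la (horiz , suc i)) k)
      (trans (sum-interval _ (suc m ∸ b (suc i)) k i (suc i) (n≤1+n i) i<k
          (λ r r<i → other-row r (<⇒≢ r<i))
          (λ r i≤r r<1+i → same-row r (≤-antisym (≤-pred r<1+i) i≤r))
          (λ r i<r → other-row r (≢-sym (<⇒≢ i<r))))
        (trans (cong (_* (suc m ∸ b (suc i))) (m+n∸n≡m 1 i)) (*-identityˡ _)))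
      where
      i<k : i < k
      i<k = subst (i <_) eq (m<m+n i (s≤s z≤n))
      cell : ℕ → ℕ → Bool
      cell r c = (r ≡ᵇ suc i) ∧ inSkew k la (r , c)
      other-row : ∀ r → r ≢ i → sum (map (λ c → indicator (cell (suc r) c)) (range1 k)) ≡ 0
      other-row r r≢i = trans (sum-interval _ 0 k 0 0 z≤n z≤n (λ _ ()) (λ _ _ ())
        (λ c _ → cong (λ t → indicator (t ∧ inSkew k la (suc r , suc c))) (reflects-false (≡ᵇ-reflects-≡ r i) r≢i))) refl
      same-row : ∀ r → r ≡ i → sum (map (λ c → indicator (cell (suc r) c)) (range1 k)) ≡ suc m ∸ b (suc i)
      same-row r refl = trans
        (sum-interval _ 1 k (b (suc i)) (suc m)
          (+-cancelˡ-≤ i _ _ (≤-trans (≤-trans (≤-reflexive (+-comm i _)) (≤-trans (+-monoʳ-≤ (b (suc i)) (n≤1+n i)) (proj₂ (desc i i<k)))) (≤-reflexive (sym eq))))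
          (≤-trans (m≤n+m (suc m) i) (≤-reflexive eq))
          (λ c c<b → entry c (reflects-false (skew-reflects i c) (λ (_ , b≤c) → <⇒≱ c<b b≤c)))
          (λ c b≤c c<m → entry c (reflects-true (skew-reflects i c) (≤-trans (+-monoʳ-≤ i c<m) (≤-reflexive eq) , b≤c)))
          (λ c m<c → entry c (reflects-false (skew-reflects i c) (λ (h , _) → <⇒≱ (s≤s m<c) (+-cancelˡ-≤ i _ _ (≤-trans h (≤-reflexive (sym eq))))))))
        (*-identityʳ _)
        where
        entry : ∀ c {t} → inSkew k la (suc i , suc c) ≡ t → indicator (cell (suc i) (suc c)) ≡ indicator t
        entry c {t} e = cong₂ (λ x y → indicator (x ∧ y)) (reflects-true (≡ᵇ-reflects-≡ i i) refl) e

    -- Row i is the last one that covers column j+1, so the column starts in row i+1 and runs down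
    -- to the antidiagonal in row k-j. At `j = b (suc i)` the value coincides with `horiz-length`:
    -- this is the equality of the two lengths at a corner.
    vert-length : ∀ i m j → i + suc m ≡ k → b (suc i) ≤ j → j < b i → arrowLength k la (vert , suc j) ≡ suc m ∸ j
    vert-length i m j eq b≤j j<b = trans (count-box (occupies k la (vert , suc j)) k)
      (trans (sum-interval _ 1 k i (k ∸ j) i≤k∸j (m∸n≤m k j)
          (λ r r<i → row r (reflects-false (skew-reflects r j) (λ (_ , b≤j′) →
            <⇒≱ (<-≤-trans j<b (b-mono r<i (<⇒≤ i<k))) b≤j′)))
          (λ r i≤r r< → let r+j<k = subst (_≤ k) (sym (+-suc r j)) (m≤o∸n⇒m+n≤o (suc r) (<⇒≤ j<k) r<) in
            row r (reflects-true (skew-reflects r j) (r+j<k , ≤-trans (b-mono (s≤s i≤r) (≤-trans r< (m∸n≤m k j))) b≤j)))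
          (λ r k∸j≤r → row r (reflects-false (skew-reflects r j) (λ (h , _) →
            <⇒≱ (subst (_≤ k) (+-suc r j) h) (≤-trans (m≤n+m∸n k j) (≤-trans (+-monoʳ-≤ j k∸j≤r) (≤-reflexive (+-comm j r))))))))
        (trans (*-identityʳ _) lengths))
      where
      i<k : i < k
      i<k = subst (i <_) eq (m<m+n i (s≤s z≤n))
      i≤k∸j : i ≤ k ∸ j
      i≤k∸j = m+n≤o⇒m≤o∸n i (≤-trans (≤-reflexive (+-comm i j)) (≤-trans (+-monoˡ-≤ i (<⇒≤ j<b)) (b-bound i (<⇒≤ i<k))))
      lengths : k ∸ j ∸ i ≡ suc m ∸ j
      lengths = trans (∸-+-assoc k j i) (trans (cong (k ∸_) (+-comm j i)) (trans (sym (∸-+-assoc k i j))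
        (cong (_∸ j) (trans (cong (_∸ i) (sym eq)) (m+n∸m≡n i (suc m))))))
      j<k : j < k
      j<k = <-≤-trans j<b (≤-trans (m≤m+n (b i) i) (b-bound i (<⇒≤ i<k)))
      row : ∀ r {t} → inSkew k la (suc r , suc j) ≡ t →
        sum (map (λ c → indicator ((c ≡ᵇ suc j) ∧ inSkew k la (suc r , c))) (range1 k)) ≡ indicator t
      row r {t} e = trans
        (sum-interval _ (indicator t) k j (suc j) (n≤1+n j) j<k
          (λ c c<j → other c (<⇒≢ c<j))
          (λ c j≤c c<1+j → same c (≤-antisym (≤-pred c<1+j) j≤c))
          (λ c j<c → other c (≢-sym (<⇒≢ j<c))))
        (trans (cong (_* indicator t) (m+n∸n≡m 1 j)) (*-identityˡ _))
        where
        other : ∀ c → c ≢ j → indicator ((c ≡ᵇ j) ∧ inSkew k la (suc r , suc c)) ≡ 0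
        other c c≢j = cong (λ x → indicator (x ∧ inSkew k la (suc r , suc c))) (reflects-false (≡ᵇ-reflects-≡ c j) c≢j)
        same : ∀ c → c ≡ j → indicator ((c ≡ᵇ j) ∧ inSkew k la (suc r , suc c)) ≡ indicator t
        same c refl = cong₂ (λ x y → indicator (x ∧ y)) (reflects-true (≡ᵇ-reflects-≡ c c) refl) e

    -- λ ∪ {(i+1, j+1)} contains (r+1, c+1): rows and columns are counted from 0 here.
    Enlarged : ℕ → ℕ → ℕ → ℕ → Set
    Enlarged i j r c = suc c ≤ b (suc r) ⊎ (r ≡ i × c ≡ j)

    AboveEnlarged LeftEnlarged : ℕ → ℕ → ℕ → ℕ → Set
    AboveEnlarged i j zero    c = ⊤
    AboveEnlarged i j (suc r) c = Enlarged i j r c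
    LeftEnlarged  i j r zero    = ⊤
    LeftEnlarged  i j r (suc c) = Enlarged i j r c

    enlarged-reflects : ∀ i j r c → Reflects (Enlarged i j r c) (inPart la (suc r , suc c) ∨ ((suc r ≡ᵇ suc i) ∧ (suc c ≡ᵇ suc j)))
    enlarged-reflects i j r c = ≤ᵇ-reflects-≤ (suc c) (b (suc r)) ⊎-reflects (≡ᵇ-reflects-≡ r i ×-reflects ≡ᵇ-reflects-≡ c j)

    above-reflects : ∀ i j r c → Reflects (AboveEnlarged i j r c)
      ((suc r ≡ᵇ 1) ∨ (inPart la (r , suc c) ∨ ((r ≡ᵇ suc i) ∧ (suc c ≡ᵇ suc j))))
    above-reflects i j zero    c = of _
    above-reflects i j (suc r) c = enlarged-reflects i j r c

    left-reflects : ∀ i j r c → Reflects (LeftEnlarged i j r c)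
      ((suc c ≡ᵇ 1) ∨ (inPart la (suc r , c) ∨ ((suc r ≡ᵇ suc i) ∧ (c ≡ᵇ suc j))))
    left-reflects i j r zero    = of _
    left-reflects i j r (suc c) = enlarged-reflects i j r c

    Corner : ℕ → ℕ → Set
    Corner i j = j ≡ b (suc i) × b (suc i) < b i

    IsPartition : ℕ → ℕ → Set
    IsPartition i j = ∀ r → r < k → ∀ c → c < k → Enlarged i j r c → AboveEnlarged i j r c × LeftEnlarged i j r c

    -- Closure needs testing only at the new cell. Its left neighbour lies in λ while the cell
    -- itself does not, which fixes j; its upper neighbour lies in λ, which gives the strict
    -- inequality. Row 1 has no upper neighbour, and there the virtual row with `b 0 = k` turns the
    -- requirement into the box bound `j < k`.
    corner-reflects : ∀ i j → i < k → j < k → Reflects (Corner i j) (outerCorner k la (suc i , suc j))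
    corner-reflects i j i<k j<k = reflects-⇔ to back (skew-reflects i j
      ×-reflects all-box-reflects _ k (λ r c → enlarged-reflects i j r c →-reflects (above-reflects i j r c ×-reflects left-reflects i j r c)))
      where
      row-above : ∀ i → i < k → AboveEnlarged i j i j → j < b i
      row-above zero    i<k _              = j<k
      row-above (suc i) i<k (inj₁ j<b)     = j<b
      row-above (suc i) i<k (inj₂ (eq , _)) = contradiction (sym eq) 1+n≢n
      column-left : ∀ j → LeftEnlarged i j i j → j ≤ b (suc i)
      column-left zero    _               = z≤n
      column-left (suc j) (inj₁ j<b)      = j<b
      column-left (suc j) (inj₂ (_ , eq)) = contradiction (sym eq) 1+n≢n
      to : (i + suc j ≤ k × b (suc i) ≤ j) × IsPartition i j → Corner i j
      to ((_ , b≤j) , closed) = ≤-antisym (column-left j left) b≤j , ≤-<-trans b≤j (row-above i i<k above)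
        where
        above = proj₁ (closed i i<k j j<k (inj₂ (refl , refl)))
        left  = proj₂ (closed i i<k j j<k (inj₂ (refl , refl)))
      back : Corner i j → (i + suc j ≤ k × b (suc i) ≤ j) × IsPartition i j
      back (refl , b<b) = (≤-trans (≤-reflexive (trans (+-suc i j) (cong suc (+-comm i j))))
          (≤-trans (≤-reflexive (sym (+-suc j i))) (proj₂ (desc i i<k))) , ≤-refl)
        , λ r r<k c c<k e → above r c r<k e , left r c e
        where
        above : ∀ r c → r < k → Enlarged i j r c → AboveEnlarged i j r c
        above zero    c r<k e                   = _
        above (suc r) c r<k (inj₁ c<b)          = inj₁ (≤-trans c<b (proj₁ (desc (suc r) r<k)))
        above (suc r) c r<k (inj₂ (refl , refl)) = inj₁ b<b
        left : ∀ r c → Enlarged i j r c → LeftEnlarged i j r c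
        left r zero    e                    = _
        left r (suc c) (inj₁ c<b)           = inj₁ (<⇒≤ c<b)
        left r (suc c) (inj₂ (refl , c≡))   = inj₁ (≤-reflexive c≡)

    count-occupies : ∀ i j as → inSkew k la (suc i , suc j) ≡ true →
      count (λ a → occupies k la a (suc i , suc j)) as ≡ multiplicity (horiz , suc i) as + multiplicity (vert , suc j) as
    count-occupies i j []       e = refl
    count-occupies i j (a ∷ as) e = begin
      count occ (a ∷ as)                                ≡⟨ count-∷ occ a as ⟩
      indicator (occ a) + count occ as                  ≡⟨ cong₂ _+_ (one a) (count-occupies i j as e) ⟩
      (h a + v a) + (multiplicity (horiz , suc i) as + multiplicity (vert , suc j) as)
        ≡⟨ interchange +-commutativeSemigroup (h a) (v a) (multiplicity (horiz , suc i) as) (multiplicity (vert , suc j) as) ⟩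
      (h a + multiplicity (horiz , suc i) as) + (v a + multiplicity (vert , suc j) as)
        ≡⟨ cong₂ _+_ (count-∷ (sameArrow (horiz , suc i)) a as) (count-∷ (sameArrow (vert , suc j)) a as) ⟨
      multiplicity (horiz , suc i) (a ∷ as) + multiplicity (vert , suc j) (a ∷ as) ∎
      where
      open ≡-Reasoning
      occ : Arrow → Bool
      occ a = occupies k la a (suc i , suc j)
      h v : Arrow → ℕ
      h a = indicator (sameArrow (horiz , suc i) a)
      v a = indicator (sameArrow (vert , suc j) a)
      ∧-true : ∀ x → x ∧ inSkew k la (suc i , suc j) ≡ x
      ∧-true x = trans (cong (x ∧_) e) (∧-identityʳ x)
      one : ∀ a → indicator (occ a) ≡ h a + v a
      one (horiz , r) = trans (cong indicator (∧-true (suc i ≡ᵇ r))) (sym (+-identityʳ _))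
      one (vert  , r) = cong indicator (∧-true (suc j ≡ᵇ r))

    -- The length test is settled by the hypothesis, and the test over the box says something only
    -- at outer corners, of which each row has at most one.
    validArrows≡rowsOK : ∀ as → All (λ a → 1 ≤ arrowLength k la a) as → validArrows k la as ≡ rowsOK b 0 k as
    validArrows≡rowsOK as positive = det
      (reflects-⇔ to back (all-reflects _ (λ a → ≤ᵇ-reflects-≤ 1 (arrowLength k la a)) as
        ×-reflects all-box-reflects _ k (λ i j → T-reflects (outerCorner k la (suc i , suc j))
          →-reflects ≤ᵇ-reflects-≤ (count (λ a → occupies k la a (suc i , suc j)) as) 1)))
      (rowsOK-reflects b as 0 k)
      where
      Uncrowded : Set
      Uncrowded = ∀ i → i < k → ∀ j → j < k → T (outerCorner k la (suc i , suc j)) →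
        count (λ a → occupies k la a (suc i , suc j)) as ≤ 1
      in-skew : ∀ i → i < k → inSkew k la (suc i , suc (b (suc i))) ≡ true
      in-skew i i<k = reflects-true (skew-reflects i (b (suc i)))
        (≤-trans (≤-reflexive (trans (+-comm i (suc (b (suc i)))) (sym (+-suc (b (suc i)) i)))) (proj₂ (desc i i<k)) , ≤-refl)
      to : All (λ a → 1 ≤ arrowLength k la a) as × Uncrowded → ∀ i → 0 ≤ i → i < k → RowOK b as i
      to (_ , uncrowded) i _ i<k b<b = subst (_≤ 1) (count-occupies i (b (suc i)) as (in-skew i i<k))
        (uncrowded i i<k (b (suc i)) bi<k
          (subst T (sym (reflects-true (corner-reflects i (b (suc i)) i<k bi<k) (refl , b<b))) _))
        where
        bi<k : b (suc i) < k
        bi<k = ≤-trans (≤-trans (s≤s (m≤m+n (b (suc i)) i)) (≤-reflexive (sym (+-suc (b (suc i)) i)))) (proj₂ (desc i i<k))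
      back : (∀ i → 0 ≤ i → i < k → RowOK b as i) → All (λ a → 1 ≤ arrowLength k la a) as × Uncrowded
      back oks = positive , uncrowded
        where
        uncrowded : Uncrowded
        uncrowded i i<k j j<k isCorner with outerCorner k la (suc i , suc j) | corner-reflects i j i<k j<k
        ... | true | ofʸ (refl , b<b) = subst (_≤ 1) (sym (count-occupies i (b (suc i)) as (in-skew i i<k))) (oks i z≤n i<k b<b)

open Configurations

open import Data.Integer using (ℤ; +_; -_; _+_; _*_; _-_; _^_; 0ℤ; 1ℤ; ∣_∣; _⊖_)
import Data.Integer.Properties as ℤ
open import Data.Integer.Tactic.RingSolver using (solve-∀)
open import Data.Nat as ℕ using (zero; suc; _∸_; _≤_; _<_; _≤ᵇ_; _<ᵇ_; z≤n; s≤s)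
import Data.Nat.Properties as ℕ
import Data.Nat.Tactic.RingSolver as ℕSolver

-- Integer polynomials are determined by their values

monomial : ℤ → ℤ × ℕ → ℤ
monomial x (c , e) = c * x ^ e

∑ : {A : Set} → (A → ℤ) → List A → ℤ
∑ f []       = 0ℤ
∑ f (x ∷ xs) = f x + ∑ f xs

eval : ℤ → Poly → ℤ
eval x = ∑ (monomial x)

∑-++ : {A : Set} (f : A → ℤ) (xs ys : List A) → ∑ f (xs ++ ys) ≡ ∑ f xs + ∑ f ys
∑-++ f []       ys = sym (ℤ.+-identityˡ _)
∑-++ f (x ∷ xs) ys = trans (cong (λ t → f x + t) (∑-++ f xs ys)) (sym (ℤ.+-assoc (f x) _ _))

∑-map : {A B : Set} (f : B → ℤ) (g : A → B) (xs : List A) → ∑ f (map g xs) ≡ ∑ (λ x → f (g x)) xs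
∑-map f g []       = refl
∑-map f g (x ∷ xs) = cong (λ t → f (g x) + t) (∑-map f g xs)

∑-concatMap : {A B : Set} (f : B → ℤ) (g : A → List B) (xs : List A) →
  ∑ f (concatMap g xs) ≡ ∑ (λ x → ∑ f (g x)) xs
∑-concatMap f g []       = refl
∑-concatMap f g (x ∷ xs) = trans (∑-++ f (g x) _) (cong (λ t → ∑ f (g x) + t) (∑-concatMap f g xs))

∑-filterᵇ : {A : Set} (f : A → ℤ) (p : A → Bool) (xs : List A) →
  ∑ f (filterᵇ p xs) ≡ ∑ (λ x → if p x then f x else 0ℤ) xs
∑-filterᵇ f p []       = refl
∑-filterᵇ f p (x ∷ xs) with p x
... | true  = cong (λ t → f x + t) (∑-filterᵇ f p xs)
... | false = trans (∑-filterᵇ f p xs) (sym (ℤ.+-identityˡ _))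

∑-cong-All : {A : Set} {f g : A → ℤ} {xs : List A} → All (λ x → f x ≡ g x) xs → ∑ f xs ≡ ∑ g xs
∑-cong-All []       = refl
∑-cong-All (e ∷ es) = cong₂ _+_ e (∑-cong-All es)

∑-cong : {A : Set} {f g : A → ℤ} → (∀ x → f x ≡ g x) → (xs : List A) → ∑ f xs ≡ ∑ g xs
∑-cong e xs = ∑-cong-All (All.universal e xs)

∑-*ˡ : {A : Set} (c : ℤ) (f : A → ℤ) (xs : List A) → ∑ (λ x → c * f x) xs ≡ c * ∑ f xs
∑-*ˡ c f []       = sym (ℤ.*-zeroʳ c)
∑-*ˡ c f (x ∷ xs) = trans (cong (λ t → c * f x + t) (∑-*ˡ c f xs)) (sym (ℤ.*-distribˡ-+ c (f x) (∑ f xs)))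

∑-zero : {A : Set} (xs : List A) → ∑ (λ _ → 0ℤ) xs ≡ 0ℤ
∑-zero []       = refl
∑-zero (x ∷ xs) = trans (ℤ.+-identityˡ _) (∑-zero xs)

∑-upTo-last : (f : ℕ → ℤ) (n : ℕ) → ∑ f (upTo (suc n)) ≡ ∑ f (upTo n) + f n
∑-upTo-last f n = trans (cong (∑ f) (sym (upTo-∷ʳ n)))
  (trans (∑-++ f (upTo n) (n ∷ [])) (cong (λ t → ∑ f (upTo n) + t) (ℤ.+-identityʳ (f n))))

∑-upTo-first : (f : ℕ → ℤ) (n : ℕ) → ∑ f (upTo (suc n)) ≡ f 0 + ∑ (λ i → f (suc i)) (upTo n)
∑-upTo-first f n = cong (λ t → f 0 + t) (trans (cong (∑ f) (sym (map-upTo suc n))) (∑-map f suc (upTo n)))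

∑-upTo-extend : (f : ℕ → ℤ) (a d : ℕ) → (∀ i → a ℕ.≤ i → f i ≡ 0ℤ) → ∑ f (upTo (d ℕ.+ a)) ≡ ∑ f (upTo a)
∑-upTo-extend f a zero    z = refl
∑-upTo-extend f a (suc d) z = trans (∑-upTo-last f (d ℕ.+ a))
  (trans (cong₂ _+_ (∑-upTo-extend f a d z) (z (d ℕ.+ a) (ℕ.m≤n+m a d))) (ℤ.+-identityʳ _))

∑-upTo-cong : {f g : ℕ → ℤ} (n : ℕ) → (∀ i → i ℕ.< n → f i ≡ g i) → ∑ f (upTo n) ≡ ∑ g (upTo n)
∑-upTo-cong n e = ∑-cong-All (All.tabulate (λ i∈ → e _ (∈-upTo⁻ i∈)))

-- Division by q after the constant term is discarded; iterated, it brings each coefficient into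
-- position 0.
shift : Poly → Poly
shift [] = []
shift ((c , zero) ∷ p) = shift p
shift ((c , suc e) ∷ p) = (c , e) ∷ shift p

coeff-shift : ∀ p n → coeff (shift p) n ≡ coeff p (suc n)
coeff-shift [] n = refl
coeff-shift ((c , zero) ∷ p) n = trans (coeff-shift p n) (sym (ℤ.+-identityˡ _))
coeff-shift ((c , suc e) ∷ p) n = cong (λ t → (if e ℕ.≡ᵇ n then c else + 0) + t) (coeff-shift p n)

eval-shift : ∀ x p → eval x p ≡ coeff p 0 + x * eval x (shift p)
eval-shift x [] = sym (trans (ℤ.+-identityˡ _) (ℤ.*-zeroʳ x))
eval-shift x ((c , zero) ∷ p) rewrite eval-shift x p = lem c (coeff p 0) (x * eval x (shift p))
  where
  lem : ∀ c d e → c * 1ℤ + (d + e) ≡ (c + d) + e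
  lem = solve-∀
eval-shift x ((c , suc e) ∷ p) rewrite eval-shift x p = lem c (coeff p 0) x (x ^ e) (eval x (shift p))
  where
  lem : ∀ c d x y e → c * (x * y) + (d + x * e) ≡ (0ℤ + d) + x * (c * y + e)
  lem = solve-∀

∣i∣<∣j∣⇒i+jy≡0⇒i≡0 : ∀ i j y → ∣ i ∣ ℕ.< ∣ j ∣ → i + j * y ≡ 0ℤ → i ≡ 0ℤ
∣i∣<∣j∣⇒i+jy≡0⇒i≡0 i j y i<j eq = ℤ.∣i∣≡0⇒i≡0 (absurd-unless-zero ∣ y ∣ ∣i∣≡)
  where
  open ≡-Reasoning
  cancel : ∀ i z → i ≡ (i + z) - z
  cancel = solve-∀
  ∣i∣≡ : ∣ i ∣ ≡ ∣ j ∣ ℕ.* ∣ y ∣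
  ∣i∣≡ = begin
    ∣ i ∣                     ≡⟨ cong ∣_∣ (cancel i (j * y)) ⟩
    ∣ i + j * y - j * y ∣     ≡⟨ cong (λ t → ∣ t - j * y ∣) eq ⟩
    ∣ 0ℤ - j * y ∣            ≡⟨ cong ∣_∣ (ℤ.+-identityˡ (- (j * y))) ⟩
    ∣ - (j * y) ∣             ≡⟨ ℤ.∣-i∣≡∣i∣ (j * y) ⟩
    ∣ j * y ∣                 ≡⟨ ℤ.abs-* j y ⟩
    ∣ j ∣ ℕ.* ∣ y ∣           ∎
  absurd-unless-zero : ∀ n → ∣ i ∣ ≡ ∣ j ∣ ℕ.* n → ∣ i ∣ ≡ 0
  absurd-unless-zero zero    e = trans e (ℕ.*-zeroʳ ∣ j ∣)
  absurd-unless-zero (suc n) e = contradiction e (ℕ.<⇒≢ (ℕ.<-≤-trans i<j (ℕ.m≤m*n ∣ j ∣ (suc n))))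

-- The constant term is divisible by every x ≥ 1, in particular by an x exceeding it.
vanishing-constant : ∀ p → (∀ m → eval (+ suc m) p ≡ 0ℤ) → coeff p 0 ≡ 0ℤ
vanishing-constant p h = ∣i∣<∣j∣⇒i+jy≡0⇒i≡0 (coeff p 0) (+ suc ∣ coeff p 0 ∣) (eval (+ suc ∣ coeff p 0 ∣) (shift p)) ℕ.≤-refl
  (trans (sym (eval-shift (+ suc ∣ coeff p 0 ∣) p)) (h _))

-- With constant term zero, the value at x is x times the value of the shift, and a positive x can
-- be cancelled. The hypothesis thus passes to the shift, and coefficient n becomes a constant term
-- after n rounds.
vanishing : ∀ p → (∀ m → eval (+ suc m) p ≡ 0ℤ) → ∀ n → coeff p n ≡ 0ℤ
vanishing p h zero = vanishing-constant p h
vanishing p h (suc n) = trans (sym (coeff-shift p n)) (vanishing (shift p) shifted n)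
  where
  shifted : ∀ m → eval (+ suc m) (shift p) ≡ 0ℤ
  shifted m = ℤ.*-cancelˡ-≡ (+ suc m) _ _ (begin
    + suc m * eval (+ suc m) (shift p) ≡⟨ ℤ.+-identityˡ _ ⟨
    0ℤ + + suc m * eval (+ suc m) (shift p) ≡⟨ cong (_+ + suc m * eval (+ suc m) (shift p)) (vanishing-constant p h) ⟨
    coeff p 0 + + suc m * eval (+ suc m) (shift p) ≡⟨ eval-shift (+ suc m) p ⟨
    eval (+ suc m) p ≡⟨ h m ⟩
    0ℤ ≡⟨ ℤ.*-zeroʳ (+ suc m) ⟨
    + suc m * 0ℤ ∎)
    where open ≡-Reasoning

negate : Poly → Poly
negate = map λ (c , e) → - c , e

coeff-++ : ∀ p r n → coeff (p ++ r) n ≡ coeff p n + coeff r n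
coeff-++ [] r n = sym (ℤ.+-identityˡ _)
coeff-++ ((c , e) ∷ p) r n =
  trans (cong (λ t → (if e ℕ.≡ᵇ n then c else + 0) + t) (coeff-++ p r n)) (sym (ℤ.+-assoc (if e ℕ.≡ᵇ n then c else + 0) _ _))

eval-negate : ∀ x p → eval x (negate p) ≡ - eval x p
eval-negate x [] = refl
eval-negate x ((c , e) ∷ p) rewrite eval-negate x p = lem c (x ^ e) (eval x p)
  where
  lem : ∀ c y e → (- c) * y + - e ≡ - (c * y + e)
  lem = solve-∀

coeff-negate : ∀ p n → coeff (negate p) n ≡ - coeff p n
coeff-negate [] n = refl
coeff-negate ((c , e) ∷ p) n with e ℕ.≡ᵇ n
... | true  = trans (cong (λ t → - c + t) (coeff-negate p n)) (sym (ℤ.neg-distrib-+ c (coeff p n)))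
... | false = trans (cong (λ t → 0ℤ + t) (coeff-negate p n)) (sym (ℤ.neg-distrib-+ 0ℤ (coeff p n)))

eval-injective : ∀ p r → (∀ x → eval x p ≡ eval x r) → p ≈ₚ r
eval-injective p r h n = ℤ.i-j≡0⇒i≡j _ _
  (trans (cong (λ t → coeff p n + t) (sym (coeff-negate r n))) (trans (sym (coeff-++ p (negate r) n)) (vanishing (p ++ negate r) zeros n)))
  where
  zeros : ∀ m → eval (+ suc m) (p ++ negate r) ≡ 0ℤ
  zeros m = trans (∑-++ (monomial (+ suc m)) p (negate r)) (trans (cong₂ _+_ (h (+ suc m)) (eval-negate (+ suc m) r)) (ℤ.+-inverseʳ (eval (+ suc m) r)))

-- Weighted lattice paths

-- Certificates for linear combinations: an identity is proved in the form left = right + sum of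
-- `c * (x - y)`, valid for free variables and hence checkable by the ring solver. Each summand is
-- then removed by a known equation `x ≡ y`.
vanish : ∀ {x y} c → x ≡ y → c * (x - y) ≡ 0ℤ
vanish {x} c refl = trans (cong (c *_) (ℤ.+-inverseʳ x)) (ℤ.*-zeroʳ c)

+-zeros₃ : ∀ {t₁ t₂ t₃} z → t₁ ≡ 0ℤ → t₂ ≡ 0ℤ → t₃ ≡ 0ℤ → z + (t₁ + t₂ + t₃) ≡ z
+-zeros₃ z refl refl refl = ℤ.+-identityʳ z

+-zeros₅ : ∀ {t₁ t₂ t₃ t₄ t₅} z → t₁ ≡ 0ℤ → t₂ ≡ 0ℤ → t₃ ≡ 0ℤ → t₄ ≡ 0ℤ → t₅ ≡ 0ℤ →
  z + (t₁ + t₂ + t₃ + t₄ + t₅) ≡ z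
+-zeros₅ z refl refl refl refl refl = ℤ.+-identityʳ z

module Paths (q : ℤ) where

  -- The total weight of h + r rows beneath a row of λ with r cells, as `chainSum` confirms. For r =
  -- 0 only the empty partition is left and the value is the product of 1 - q^j for j from 1 to h.
  -- The clause at height 0 is the general recurrence there, whose first term carries the factor 1 -
  -- q^0 = 0.
  walks : ℕ → ℕ → ℤ
  walks zero    zero    = 1ℤ
  walks (suc h) zero    = (1ℤ - q ^ suc h) * walks h zero
  walks zero    (suc r) =
    (1ℤ - q) * walks 1 r - (q ^ suc r * q ^ suc r) * walks 0 r
  walks (suc h) (suc r) =
    (q ^ suc r * q ^ suc r) * (1ℤ - q ^ suc h) * walks h (suc r)
    + (1ℤ - q ^ suc (suc h)) * walks (suc (suc h)) r
    - (q ^ suc h * q ^ suc r) * (q ^ suc h * q ^ suc r) * walks (suc h) r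

  -- The value 0 at r = 0 lets both recurrences be stated without a separate case for r = 0.
  previous : ℕ → ℕ → ℤ
  previous h zero    = 0ℤ
  previous h (suc r) = walks h r

  walks-suc : ∀ h r → walks (suc h) r ≡
    (q ^ r * q ^ r) * (1ℤ - q ^ suc h) * walks h r
    + (1ℤ - q ^ suc (suc h)) * previous (suc (suc h)) r
    - (q ^ suc h * q ^ r) * (q ^ suc h * q ^ r) * previous (suc h) r
  walks-suc h zero = lem (1ℤ - q ^ suc h) (1ℤ - q ^ suc (suc h)) (q ^ suc h) (walks h zero)
    where
    lem : ∀ a b c w → a * w ≡ 1ℤ * 1ℤ * a * w + b * 0ℤ - (c * 1ℤ) * (c * 1ℤ) * 0ℤ
    lem = solve-∀
  walks-suc h (suc r) = refl

  -- The induction is lexicographic, on r and within it on h: the instances used at r - 1 have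
  -- larger heights, up to h + 1, while the one at the same r has height h - 1.
  pascal : ∀ h r → walks (suc h) r ≡
    (1ℤ - q ^ suc h * (q ^ r * q ^ r)) * walks h r + q ^ suc h * previous (suc h) r
  pascal h zero = lem (q ^ suc h) (walks h zero)
    where
    lem : ∀ a w → (1ℤ - a) * w ≡ (1ℤ - a * (1ℤ * 1ℤ)) * w + a * 0ℤ
    lem = solve-∀
  -- This is the certificate of the general case at a = 1. There the multiplier of the fifth
  -- relation vanishes, and the fourth relation is the defining clause of `walks 0 (suc r)`,
  -- substituted through `A`.
  pascal zero (suc r) = trans
    (identity q (q ^ r) (walks 2 r) (walks 1 r) (walks 0 r) (previous 2 r) (previous 1 r))
    (+-zeros₃ _ (vanish (1ℤ - q * q) (pascal 1 r)) (vanish (- (q * q)) (walks-suc 0 r))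
      (vanish (- (q * q * q * q ^ r * q ^ r)) (pascal 0 r)))
    where
    identity : ∀ q b B C E G K →
      let A = (1ℤ - q) * C - ((q * b) * (q * b)) * E in
      ((q * b) * (q * b)) * (1ℤ - q * 1ℤ) * A + (1ℤ - q * (q * 1ℤ)) * B
        - ((q * 1ℤ) * (q * b)) * ((q * 1ℤ) * (q * b)) * C
      ≡ ((1ℤ - (q * 1ℤ) * ((q * b) * (q * b))) * A + (q * 1ℤ) * C)
        + ((1ℤ - q * q) * (B - ((1ℤ - q * (q * 1ℤ) * (b * b)) * C + q * (q * 1ℤ) * G))
        + - (q * q) * (C - ((b * b) * (1ℤ - q * 1ℤ) * E + (1ℤ - q * (q * 1ℤ)) * G - ((q * 1ℤ) * b) * ((q * 1ℤ) * b) * K))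
        + - (q * q * q * b * b) * (C - ((1ℤ - (q * 1ℤ) * (b * b)) * E + (q * 1ℤ) * K)))
    identity = solve-∀
  -- The multipliers are found by elimination: `G` cancels between the first and second relations,
  -- `K` between the second and third, and `A′` between the fourth and fifth.
  pascal (suc h) (suc r) = trans
    (identity q (q ^ h) (q ^ r) (walks (suc h) (suc r)) (walks h (suc r)) (walks (3 ℕ.+ h) r) (walks (2 ℕ.+ h) r) (walks (suc h) r)
      (previous (3 ℕ.+ h) r) (previous (2 ℕ.+ h) r))
    (+-zeros₅ _
      (vanish (1ℤ - q * (q * a)) (pascal (2 ℕ.+ h) r))
      (vanish (- (q * q * a)) (walks-suc (suc h) r))
      (vanish (- (q * q * q * a * a * b * b)) (pascal (suc h) r))
      (vanish (- (1ℤ - q * q * a * b * b)) (walks-suc h (suc r)))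
      (vanish (q * q * b * b - q * q * a * b * b) (pascal h (suc r))))
    where
    a = q ^ suc h
    b = q ^ r
    identity : ∀ q c b A A′ B C E G K → let a = q * c in
      ((q * b) * (q * b)) * (1ℤ - q * a) * A + (1ℤ - q * (q * a)) * B
        - ((q * a) * (q * b)) * ((q * a) * (q * b)) * C
      ≡ ((1ℤ - (q * a) * ((q * b) * (q * b))) * A + (q * a) * C)
        + ((1ℤ - q * (q * a)) * (B - ((1ℤ - q * (q * a) * (b * b)) * C + q * (q * a) * G))
        + - (q * q * a) * (C - ((b * b) * (1ℤ - q * a) * E + (1ℤ - q * (q * a)) * G - ((q * a) * b) * ((q * a) * b) * K))
        + - (q * q * q * a * a * b * b) * (C - ((1ℤ - (q * a) * (b * b)) * E + (q * a) * K))
        + - (1ℤ - q * q * a * b * b) * (A - (((q * b) * (q * b)) * (1ℤ - a) * A′ + (1ℤ - q * a) * C - (a * (q * b)) * (a * (q * b)) * E))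
        + (q * q * b * b - q * q * a * b * b) * (A - ((1ℤ - a * ((q * b) * (q * b))) * A′ + a * E)))
    identity = solve-∀


  odd-power : ∀ n → q ^ suc (2 ℕ.* n) ≡ q * (q ^ n * q ^ n)
  odd-power n = cong (q *_) (trans (cong (λ m → q ^ (n ℕ.+ m)) (ℕ.+-identityʳ n)) (ℤ.^-distribˡ-+-* q n n))

  -- `pascal` trades `walks 1 (suc r)` for `walks 0 (suc r)` and `walks 1 r`. The latter occurs only
  -- as (1 - q) `walks 1 r`, which the clause defining `walks 0 (suc r)` expresses by diagonal
  -- values.
  diagonal-step : ∀ r → walks 0 (2 ℕ.+ r) - walks 0 (suc r) ≡
    - q ^ suc (2 ℕ.* suc r) * (walks 0 (suc r) - walks 0 r)
  diagonal-step r = trans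
    (cong (λ w → (1ℤ - q) * w - (q ^ (2 ℕ.+ r) * q ^ (2 ℕ.+ r)) * walks 0 (suc r) - walks 0 (suc r)) (pascal 0 (suc r)))
    (trans (identity q (q ^ r) (walks 1 r) (walks 0 r))
      (cong (λ t → - t * (walks 0 (suc r) - walks 0 r)) (sym (odd-power (suc r)))))
    where
    identity : ∀ q b X Y → let Z = (1ℤ - q) * X - ((q * b) * (q * b)) * Y in
      (1ℤ - q) * ((1ℤ - (q * 1ℤ) * ((q * b) * (q * b))) * Z + (q * 1ℤ) * X) - ((q * (q * b)) * (q * (q * b))) * Z - Z
      ≡ - (q * ((q * b) * (q * b))) * (Z - Y)
    identity = solve-∀

  theta : ℕ → ℤ
  theta n = monomial q (negqPow (n ℕ.* n))

  -1^odd : ∀ n → (- 1ℤ) ^ suc (2 ℕ.* n) ≡ - 1ℤ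
  -1^odd n = cong (- 1ℤ *_) (trans (sym (ℤ.^-*-assoc (- 1ℤ) 2 n)) (ℤ.^-zeroˡ n))

  -- Consecutive squares differ by the odd number 2n + 1, hence the sign. At n = r + 1 the ratio is
  -- the one in `diagonal-step`.
  theta-suc : ∀ n → theta (suc n) ≡ - q ^ suc (2 ℕ.* n) * theta n
  theta-suc n = begin
    (- 1ℤ) ^ (suc n ℕ.* suc n) * q ^ (suc n ℕ.* suc n)
      ≡⟨ cong (λ m → (- 1ℤ) ^ m * q ^ m) (square n) ⟩
    (- 1ℤ) ^ (suc (2 ℕ.* n) ℕ.+ n ℕ.* n) * q ^ (suc (2 ℕ.* n) ℕ.+ n ℕ.* n)
      ≡⟨ cong₂ _*_ (ℤ.^-distribˡ-+-* (- 1ℤ) (suc (2 ℕ.* n)) (n ℕ.* n)) (ℤ.^-distribˡ-+-* q (suc (2 ℕ.* n)) (n ℕ.* n)) ⟩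
    ((- 1ℤ) ^ suc (2 ℕ.* n) * (- 1ℤ) ^ (n ℕ.* n)) * (q ^ suc (2 ℕ.* n) * q ^ (n ℕ.* n))
      ≡⟨ cong (λ t → (t * (- 1ℤ) ^ (n ℕ.* n)) * (q ^ suc (2 ℕ.* n) * q ^ (n ℕ.* n))) (-1^odd n) ⟩
    (- 1ℤ * (- 1ℤ) ^ (n ℕ.* n)) * (q ^ suc (2 ℕ.* n) * q ^ (n ℕ.* n))
      ≡⟨ identity ((- 1ℤ) ^ (n ℕ.* n)) (q ^ suc (2 ℕ.* n)) (q ^ (n ℕ.* n)) ⟩
    - q ^ suc (2 ℕ.* n) * theta n ∎
    where
    open ≡-Reasoning
    square : ∀ n → suc n ℕ.* suc n ≡ suc (2 ℕ.* n) ℕ.+ n ℕ.* n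
    square = ℕSolver.solve-∀
    identity : ∀ s t u → (- 1ℤ * s) * (t * u) ≡ - t * (s * u)
    identity = solve-∀

  -- Both sides obey the same first-order recurrence, so all depends on the start: (1 - q)² - q² - 1
  -- = -2q.
  walks-diagonal : ∀ k → walks 0 (suc k) - walks 0 k ≡ theta (suc k) + theta (suc k)
  walks-diagonal zero = identity q
    where
    identity : ∀ q → (1ℤ - q) * ((1ℤ - q * 1ℤ) * 1ℤ) - ((q * 1ℤ) * (q * 1ℤ)) * 1ℤ - 1ℤ
      ≡ (- 1ℤ * 1ℤ) * (q * 1ℤ) + (- 1ℤ * 1ℤ) * (q * 1ℤ)
    identity = solve-∀
  walks-diagonal (suc k) = begin
    walks 0 (2 ℕ.+ k) - walks 0 (suc k)                          ≡⟨ diagonal-step k ⟩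
    - q ^ suc (2 ℕ.* suc k) * (walks 0 (suc k) - walks 0 k)      ≡⟨ cong (- q ^ suc (2 ℕ.* suc k) *_) (walks-diagonal k) ⟩
    - q ^ suc (2 ℕ.* suc k) * (theta (suc k) + theta (suc k))    ≡⟨ ℤ.*-distribˡ-+ (- q ^ suc (2 ℕ.* suc k)) _ _ ⟩
    - q ^ suc (2 ℕ.* suc k) * theta (suc k) + - q ^ suc (2 ℕ.* suc k) * theta (suc k)
      ≡⟨ cong₂ _+_ (theta-suc (suc k)) (theta-suc (suc k)) ⟨
    theta (2 ℕ.+ k) + theta (2 ℕ.+ k) ∎
    where open ≡-Reasoning

-- Summation over partitions

if-∧ : ∀ a b {x : ℤ} → (if a ∧ b then x else 0ℤ) ≡ (if a then (if b then x else 0ℤ) else 0ℤ)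
if-∧ true  b = refl
if-∧ false b = refl

∑-if : {A : Set} (b : Bool) (f : A → ℤ) (xs : List A) →
  ∑ (λ x → if b then f x else 0ℤ) xs ≡ (if b then ∑ f xs else 0ℤ)
∑-if true  f xs = refl
∑-if false f xs = ∑-zero xs

*-if : ∀ c b x → (if b then c * x else 0ℤ) ≡ c * (if b then x else 0ℤ)
*-if c true  x = refl
*-if c false x = sym (ℤ.*-zeroʳ c)

module _ (q : ℤ) where
  open Paths q
  open ≡-Reasoning

  -- Passing to k + 1 adds one term at each end, for i = -(k+1) and i = k+1, and recentres the rest;
  -- the two new terms are the increment in `walks-diagonal`.
  theta-sum : ∀ k → ∑ (λ n → theta ∣ n ⊖ k ∣) (upTo (suc (2 ℕ.* k))) ≡ walks 0 k
  theta-sum zero = refl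
  theta-sum (suc k) = begin
    ∑ (f (suc k)) (upTo (suc (2 ℕ.* suc k)))
      ≡⟨ cong (λ n → ∑ (f (suc k)) (upTo (suc n))) (ℕ.*-suc 2 k) ⟩
    ∑ (f (suc k)) (upTo (3 ℕ.+ 2 ℕ.* k))
      ≡⟨ ∑-upTo-first (f (suc k)) (2 ℕ.+ 2 ℕ.* k) ⟩
    theta (suc k) + ∑ (λ n → f (suc k) (suc n)) (upTo (2 ℕ.+ 2 ℕ.* k))
      ≡⟨ cong (λ t → theta (suc k) + t) (∑-cong (λ n → cong (λ z → theta ∣ z ∣) (ℤ.[1+m]⊖[1+n]≡m⊖n n k)) (upTo (2 ℕ.+ 2 ℕ.* k))) ⟩
    theta (suc k) + ∑ (f k) (upTo (2 ℕ.+ 2 ℕ.* k))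
      ≡⟨ cong (λ t → theta (suc k) + t) (∑-upTo-last (f k) (suc (2 ℕ.* k))) ⟩
    theta (suc k) + (∑ (f k) (upTo (suc (2 ℕ.* k))) + theta ∣ suc (2 ℕ.* k) ⊖ k ∣)
      ≡⟨ cong₂ (λ s t → theta (suc k) + (s + theta t)) (theta-sum k) last ⟩
    theta (suc k) + (walks 0 k + theta (suc k))
      ≡⟨ rearrange (theta (suc k)) (walks 0 k) ⟩
    (theta (suc k) + theta (suc k)) + walks 0 k
      ≡⟨ cong (_+ walks 0 k) (walks-diagonal k) ⟨
    (walks 0 (suc k) - walks 0 k) + walks 0 k
      ≡⟨ cancel (walks 0 (suc k)) (walks 0 k) ⟩
    walks 0 (suc k) ∎
    where
    f : ℕ → ℕ → ℤ
    f k n = theta ∣ n ⊖ k ∣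
    last : ∣ suc (2 ℕ.* k) ⊖ k ∣ ≡ suc k
    last = begin
      ∣ suc (2 ℕ.* k) ⊖ k ∣ ≡⟨ cong (λ m → ∣ suc m ⊖ k ∣) (cong (k ℕ.+_) (ℕ.+-identityʳ k)) ⟩
      ∣ suc k ℕ.+ k ⊖ k ∣   ≡⟨ cong ∣_∣ (ℤ.⊖-≥ (ℕ.m≤n+m k (suc k))) ⟩
      (suc k ℕ.+ k) ∸ k     ≡⟨ ℕ.m+n∸n≡m (suc k) k ⟩
      suc k                 ∎
    rearrange : ∀ a b → a + (b + a) ≡ (a + a) + b
    rearrange = solve-∀
    cancel : ∀ a b → (a - b) + b ≡ a
    cancel = solve-∀

  eval-rhs : ∀ k → eval q (rhs k) ≡ walks 0 k
  eval-rhs k = begin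
    eval q (rhs k)
      ≡⟨ ∑-map (monomial q) (λ i → negqPow (∣ i ∣ ℕ.* ∣ i ∣)) (map (λ n → + n - + k) (upTo (suc (2 ℕ.* k)))) ⟩
    ∑ (λ i → theta ∣ i ∣) (map (λ n → + n - + k) (upTo (suc (2 ℕ.* k))))
      ≡⟨ ∑-map (λ i → theta ∣ i ∣) (λ n → + n - + k) (upTo (suc (2 ℕ.* k))) ⟩
    ∑ (λ n → theta ∣ + n - + k ∣) (upTo (suc (2 ℕ.* k)))
      ≡⟨ ∑-cong (λ n → cong (λ i → theta ∣ i ∣) (ℤ.m-n≡m⊖n n k)) (upTo (suc (2 ℕ.* k))) ⟩
    ∑ (λ n → theta ∣ n ⊖ k ∣) (upTo (suc (2 ℕ.* k)))
      ≡⟨ theta-sum k ⟩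
    walks 0 k ∎

  -- Factors of single rows, and summation over the top row

  columns : ℕ → ℕ → ℕ → ℤ
  columns m t zero    = 1ℤ
  columns m t (suc d) = (1ℤ - q ^ (m ∸ t)) * columns m (suc t) d

  columns-last : ∀ m t d → columns m t (suc d) ≡ columns m t d * (1ℤ - q ^ (m ∸ (t ℕ.+ d)))
  columns-last m t zero = trans (ℤ.*-comm (1ℤ - q ^ (m ∸ t)) 1ℤ) (cong (λ e → 1ℤ * (1ℤ - q ^ (m ∸ e))) (sym (ℕ.+-identityʳ t)))
  columns-last m t (suc d) = begin
    (1ℤ - q ^ (m ∸ t)) * columns m (suc t) (suc d)
      ≡⟨ cong ((1ℤ - q ^ (m ∸ t)) *_) (columns-last m (suc t) d) ⟩
    (1ℤ - q ^ (m ∸ t)) * (columns m (suc t) d * (1ℤ - q ^ (m ∸ (suc t ℕ.+ d))))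
      ≡⟨ ℤ.*-assoc (1ℤ - q ^ (m ∸ t)) (columns m (suc t) d) _ ⟨
    columns m t (suc d) * (1ℤ - q ^ (m ∸ (suc t ℕ.+ d)))
      ≡⟨ cong (λ e → columns m t (suc d) * (1ℤ - q ^ (m ∸ e))) (ℕ.+-suc t d) ⟨
    columns m t (suc d) * (1ℤ - q ^ (m ∸ (t ℕ.+ suc d))) ∎

  -- The factor of a row with m cells in δ_k and t cells in λ, below a row with t + d cells in λ;
  -- it includes the columns t + 1, …, t + d, which λ leaves just above this row.
  block : ℕ → ℕ → ℕ → ℤ
  block m t zero    = 1ℤ - q ^ (m ∸ t)
  block m t (suc d) = (1ℤ - q ^ (m ∸ t) - q ^ (m ∸ t)) * columns m (suc t) d

  -- When a corner is already present, lengthening the row above merely adds one more column that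
  -- misses the corners. The passage from no overhang to overhang 1 creates the corner and obeys a
  -- different rule, handled in `rowSum`.
  block-last : ∀ m t d → block m t (2 ℕ.+ d) ≡ (1ℤ - q ^ (m ∸ (t ℕ.+ suc d))) * block m t (suc d)
  block-last m t d = begin
    c * columns m (suc t) (suc d)                    ≡⟨ cong (c *_) (columns-last m (suc t) d) ⟩
    c * (columns m (suc t) d * (1ℤ - q ^ (m ∸ (suc t ℕ.+ d))))   ≡⟨ cong (λ e → c * (columns m (suc t) d * (1ℤ - q ^ (m ∸ e)))) (ℕ.+-suc t d) ⟨
    c * (columns m (suc t) d * y)                    ≡⟨ rearrange c (columns m (suc t) d) y ⟩
    y * block m t (suc d)                            ∎
    where
    c = 1ℤ - q ^ (m ∸ t) - q ^ (m ∸ t)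
    y = 1ℤ - q ^ (m ∸ (t ℕ.+ suc d))
    rearrange : ∀ a b c → a * (b * c) ≡ c * (a * b)
    rearrange = solve-∀

  -- The contribution of a top row with t cells beneath a row with s cells, when n further rows
  -- follow; these lie beneath a row with t cells, which gives the last factor.
  rowTerm : ℕ → ℕ → ℕ → ℤ
  rowTerm n s t = (q ^ t * q ^ t) * block (suc n) t (s ∸ t) * walks (n ∸ t) t

  -- The condition t ≤ n is containment in δ_{k-1}. Without it the truncated `n ∸ t` would produce a
  -- spurious term at t = n + 1.
  guarded : ℕ → ℕ → ℕ → ℤ
  guarded n s t = if t ≤ᵇ n then rowTerm n s t else 0ℤ

  guarded-≤ : ∀ n t s → t ℕ.≤ n → guarded n s t ≡ rowTerm n s t
  guarded-≤ n t s t≤n with t ≤ᵇ n | ℕ.≤⇒≤ᵇ t≤n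
  ... | true | _ = refl

  guarded-> : ∀ n t s → n ℕ.< t → guarded n s t ≡ 0ℤ
  guarded-> n t s n<t with t ≤ᵇ n in eq
  ... | false = refl
  ... | true  = contradiction (ℕ.≤ᵇ⇒≤ t n (subst T (sym eq) _)) (ℕ.<⇒≱ n<t)

  rowTerm-diagonal : ∀ n s → rowTerm n s s ≡ (q ^ s * q ^ s) * (1ℤ - q ^ (suc n ∸ s)) * walks (n ∸ s) s
  rowTerm-diagonal n s = cong (λ d → (q ^ s * q ^ s) * block (suc n) s d * walks (n ∸ s) s) (ℕ.n∸n≡0 s)

  rowTerm-suc : ∀ n s t → t ℕ.< s → rowTerm n (suc s) t ≡ (1ℤ - q ^ (suc n ∸ s)) * rowTerm n s t
  rowTerm-suc n s t t<s = begin
    c * block (suc n) t (suc s ∸ t) * w      ≡⟨ cong (λ d → c * block (suc n) t d * w) (trans (ℕ.+-∸-assoc 1 (ℕ.<⇒≤ t<s)) (cong suc s∸t≡)) ⟩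
    c * block (suc n) t (2 ℕ.+ d) * w        ≡⟨ cong (λ b → c * b * w) (block-last (suc n) t d) ⟩
    c * ((1ℤ - q ^ (suc n ∸ (t ℕ.+ suc d))) * block (suc n) t (suc d)) * w
      ≡⟨ cong₂ (λ e f → c * ((1ℤ - q ^ (suc n ∸ e)) * block (suc n) t f) * w) (trans (cong (t ℕ.+_) (sym s∸t≡)) (ℕ.m+[n∸m]≡n (ℕ.<⇒≤ t<s))) (sym s∸t≡) ⟩
    c * ((1ℤ - q ^ (suc n ∸ s)) * block (suc n) t (s ∸ t)) * w
      ≡⟨ rearrange c (1ℤ - q ^ (suc n ∸ s)) (block (suc n) t (s ∸ t)) w ⟩
    (1ℤ - q ^ (suc n ∸ s)) * rowTerm n s t ∎
    where
    c = q ^ t * q ^ t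
    w = walks (n ∸ t) t
    d = s ∸ suc t
    s∸t≡ : s ∸ t ≡ suc d
    s∸t≡ = ℕ.+-∸-assoc 1 t<s
    rearrange : ∀ a b c d → a * (b * c) * d ≡ b * (a * c * d)
    rearrange = solve-∀

  -- Induction on the length s of the row above. When s grows by one, every term with t < s gains
  -- the factor of one new column, the term t = s acquires a corner, and the term t = s + 1 is new.
  -- Collected, these changes are the three terms of the recurrence for `walks`.
  rowSum : ∀ n s → s ℕ.≤ suc n → ∑ (guarded n s) (upTo (suc s)) ≡ walks (suc n ∸ s) s
  rowSum n zero s≤ = trans (ℤ.+-identityʳ _) (identity (1ℤ - q ^ suc n) (walks n 0))
    where
    identity : ∀ a w → 1ℤ * 1ℤ * a * w ≡ a * w
    identity = solve-∀
  rowSum n (suc s) (ℕ.s≤s s≤n) = begin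
    ∑ (guarded n (suc s)) (upTo (2 ℕ.+ s))
      ≡⟨ ∑-upTo-last (guarded n (suc s)) (suc s) ⟩
    ∑ (guarded n (suc s)) (upTo (suc s)) + guarded n (suc s) (suc s)
      ≡⟨ cong (_+ guarded n (suc s) (suc s)) (trans (∑-upTo-last (guarded n (suc s)) s) (cong₂ _+_ below (guarded-≤ n s (suc s) s≤n))) ⟩
    y * ∑ (guarded n s) (upTo s) + rowTerm n (suc s) s + guarded n (suc s) (suc s)
      ≡⟨ cong (λ t → y * ∑ (guarded n s) (upTo s) + t + guarded n (suc s) (suc s)) corner ⟩
    y * ∑ (guarded n s) (upTo s) + (y * guarded n s s - z * walks (n ∸ s) s) + guarded n (suc s) (suc s)
      ≡⟨ rearrange y (∑ (guarded n s) (upTo s)) (guarded n s s) (z * walks (n ∸ s) s) (guarded n (suc s) (suc s)) ⟩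
    guarded n (suc s) (suc s) + y * (∑ (guarded n s) (upTo s) + guarded n s s) - z * walks (n ∸ s) s
      ≡⟨ cong (λ t → guarded n (suc s) (suc s) + y * t - z * walks (n ∸ s) s) (trans (sym (∑-upTo-last (guarded n s) s)) (rowSum n s (ℕ.m≤n⇒m≤1+n s≤n))) ⟩
    guarded n (suc s) (suc s) + y * walks (suc n ∸ s) s - z * walks (n ∸ s) s
      ≡⟨ cong (λ e → guarded n (suc s) (suc s) + (1ℤ - q ^ e) * walks e s - z * walks (n ∸ s) s) suc-∸ ⟩
    guarded n (suc s) (suc s) + (1ℤ - q ^ suc (n ∸ s)) * walks (suc (n ∸ s)) s - z * walks (n ∸ s) s
      ≡⟨ finish (n ∸ s) refl ⟩
    walks (n ∸ s) (suc s) ∎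
    where
    y = 1ℤ - q ^ (suc n ∸ s)
    -- The square of q^(n+1), left split as in the clause of `walks` at height n - s.
    z = (q ^ (n ∸ s) * q ^ suc s) * (q ^ (n ∸ s) * q ^ suc s)
    below : ∑ (guarded n (suc s)) (upTo s) ≡ y * ∑ (guarded n s) (upTo s)
    below = trans (∑-upTo-cong s (λ t t<s → let t≤n = ℕ.≤-trans (ℕ.<⇒≤ t<s) s≤n in
        trans (guarded-≤ n t (suc s) t≤n) (trans (rowTerm-suc n s t t<s) (cong (y *_) (sym (guarded-≤ n t s t≤n))))))
      (∑-*ˡ y (guarded n s) (upTo s))
    suc-∸ : suc n ∸ s ≡ suc (n ∸ s)
    suc-∸ = ℕ.+-∸-assoc 1 s≤n
    corner : rowTerm n (suc s) s ≡ y * guarded n s s - z * walks (n ∸ s) s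
    corner = begin
      rowTerm n (suc s) s
        ≡⟨ cong (λ d → (q ^ s * q ^ s) * block (suc n) s d * walks (n ∸ s) s) (trans (ℕ.+-∸-assoc 1 (ℕ.≤-refl {s})) (cong suc (ℕ.n∸n≡0 s))) ⟩
      (q ^ s * q ^ s) * ((1ℤ - q ^ (suc n ∸ s) - q ^ (suc n ∸ s)) * 1ℤ) * walks (n ∸ s) s
        ≡⟨ cong (λ e → (q ^ s * q ^ s) * ((1ℤ - q ^ e - q ^ e) * 1ℤ) * walks (n ∸ s) s) suc-∸ ⟩
      (q ^ s * q ^ s) * ((1ℤ - q ^ suc (n ∸ s) - q ^ suc (n ∸ s)) * 1ℤ) * walks (n ∸ s) s
        ≡⟨ identity q (q ^ s) (q ^ (n ∸ s)) (walks (n ∸ s) s) ⟩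
      (1ℤ - q ^ suc (n ∸ s)) * ((q ^ s * q ^ s) * (1ℤ - q ^ suc (n ∸ s)) * walks (n ∸ s) s) - z * walks (n ∸ s) s
        ≡⟨ cong (λ e → (1ℤ - q ^ e) * ((q ^ s * q ^ s) * (1ℤ - q ^ e) * walks (n ∸ s) s) - z * walks (n ∸ s) s) suc-∸ ⟨
      y * ((q ^ s * q ^ s) * y * walks (n ∸ s) s) - z * walks (n ∸ s) s
        ≡⟨ cong (λ t → y * t - z * walks (n ∸ s) s) (trans (guarded-≤ n s s s≤n) (rowTerm-diagonal n s)) ⟨
      y * guarded n s s - z * walks (n ∸ s) s ∎
      where
      identity : ∀ q b a w → (b * b) * ((1ℤ - q * a - q * a) * 1ℤ) * w
        ≡ (1ℤ - q * a) * ((b * b) * (1ℤ - q * a) * w) - (a * (q * b)) * (a * (q * b)) * w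
      identity = solve-∀
    rearrange : ∀ y a b c d → y * a + (y * b - c) + d ≡ d + y * (a + b) - c
    rearrange = solve-∀
    finish : ∀ h → n ∸ s ≡ h →
      guarded n (suc s) (suc s) + (1ℤ - q ^ suc h) * walks (suc h) s - (q ^ h * q ^ suc s) * (q ^ h * q ^ suc s) * walks h s
      ≡ walks h (suc s)
    -- Here s = n, so a top row with s + 1 cells would leave δ_{k-1}; the guard removes the term
    -- that the clause of `walks` at height 0 lacks.
    finish zero n∸s≡0 = trans
      (cong (λ t → t + (1ℤ - q ^ 1) * walks 1 s - (1ℤ * q ^ suc s) * (1ℤ * q ^ suc s) * walks 0 s)
        (guarded-> n (suc s) (suc s) (ℕ.s≤s (ℕ.m∸n≡0⇒m≤n {n} {s} n∸s≡0))))
      (identity q (q ^ suc s) (walks 1 s) (walks 0 s))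
      where
      identity : ∀ q b v w → 0ℤ + (1ℤ - q * 1ℤ) * v - (1ℤ * b) * (1ℤ * b) * w ≡ (1ℤ - q) * v - (b * b) * w
      identity = solve-∀
    finish (suc h) n∸s≡ = cong
      (λ t → t + (1ℤ - q ^ (2 ℕ.+ h)) * walks (2 ℕ.+ h) s - (q ^ suc h * q ^ suc s) * (q ^ suc h * q ^ suc s) * walks (suc h) s)
      (trans (guarded-≤ n (suc s) (suc s) (ℕ.m∸n≢0⇒n<m {n} {s} (λ n∸s≡0 → ℕ.1+n≢0 (trans (sym n∸s≡) n∸s≡0))))
        (trans (rowTerm-diagonal n (suc s))
          (cong₂ (λ d e → (q ^ suc s * q ^ suc s) * (1ℤ - q ^ d) * walks e (suc s)) n∸s≡
            (trans (sym (ℕ.pred[m∸n]≡m∸[1+n] n s)) (cong ℕ.pred n∸s≡)))))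

  rows : (ℕ → ℕ) → ℕ → ℕ → ℤ
  rows b i zero    = 1ℤ
  rows b i (suc m) = block (suc m) (b (suc i)) (b i ∸ b (suc i)) * rows b (suc i) m

  rows-shift : ∀ b i m → rows b (suc i) m ≡ rows (λ j → b (suc j)) i m
  rows-shift b i zero    = refl
  rows-shift b i (suc m) = cong (block (suc m) (b (2 ℕ.+ i)) (b (suc i) ∸ b (2 ℕ.+ i)) *_) (rows-shift b (suc i) m)

  partitionWeight : ℕ → ℕ → List ℕ → ℤ
  partitionWeight n s la = (q ^ size la * q ^ size la) * rows (boundary s la) 0 n

  chainWeight : ℕ → ℕ → List ℕ → ℤ
  chainWeight n s la = if chain (boundary s la) 0 n then partitionWeight n s la else 0ℤ

  chainWeight-∷ : ∀ n s t la → chainWeight (suc n) s (t ∷ la) ≡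
    (if t ≤ᵇ s then (if t ≤ᵇ n then ((q ^ t * q ^ t) * block (suc n) t (s ∸ t)) * chainWeight n t la else 0ℤ) else 0ℤ)
  chainWeight-∷ n s t la = begin
    (if (t ≤ᵇ s) ∧ (t ≤ᵇ n) ∧ chain (boundary s (t ∷ la)) 1 n then w else 0ℤ)
      ≡⟨ trans (if-∧ (t ≤ᵇ s) _) (cong (λ x → if t ≤ᵇ s then x else 0ℤ) (if-∧ (t ≤ᵇ n) _)) ⟩
    (if t ≤ᵇ s then (if t ≤ᵇ n then (if chain (boundary s (t ∷ la)) 1 n then w else 0ℤ) else 0ℤ) else 0ℤ)
      ≡⟨ cong (λ x → if t ≤ᵇ s then (if t ≤ᵇ n then x else 0ℤ) else 0ℤ)
           (trans (cong₂ (λ b x → if b then x else 0ℤ) (chain-shift (boundary s (t ∷ la)) 0 n) w≡) (*-if c (chain (boundary t la) 0 n) _)) ⟩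
    (if t ≤ᵇ s then (if t ≤ᵇ n then c * chainWeight n t la else 0ℤ) else 0ℤ) ∎
    where
    w = partitionWeight (suc n) s (t ∷ la)
    c = (q ^ t * q ^ t) * block (suc n) t (s ∸ t)
    rearrange : ∀ a b x y → ((a * b) * (a * b)) * (x * y) ≡ ((a * a) * x) * ((b * b) * y)
    rearrange = solve-∀
    w≡ : w ≡ c * partitionWeight n t la
    w≡ = trans
      (cong₂ (λ x y → (x * x) * (block (suc n) t (s ∸ t) * y)) (ℤ.^-distribˡ-+-* q t (size la)) (rows-shift (boundary s (t ∷ la)) 0 n))
      (rearrange (q ^ t) (q ^ size la) (block (suc n) t (s ∸ t)) (rows (boundary t la) 0 n))

  -- `M` bounds the entries of the enumerated lists and stays fixed while the number of rows falls.
  -- Entries above s contribute nothing, so the range shrinks to 0, ..., s, and the chosen entry t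
  -- plays the role of s for the remaining rows.
  chainSum : ∀ M n s → n ℕ.≤ M → s ℕ.≤ n → ∑ (chainWeight n s) (vecs M n) ≡ walks (n ∸ s) s
  chainSum M zero    zero n≤M s≤n = refl
  chainSum M (suc n) s    n<M s≤n = begin
    ∑ (chainWeight (suc n) s) (vecs M (suc n))
      ≡⟨ ∑-concatMap (chainWeight (suc n) s) (λ t → map (t ∷_) (vecs M n)) (upTo (suc M)) ⟩
    ∑ (λ t → ∑ (chainWeight (suc n) s) (map (t ∷_) (vecs M n))) (upTo (suc M))
      ≡⟨ ∑-cong (λ t → trans (∑-map (chainWeight (suc n) s) (t ∷_) (vecs M n)) (first-row t)) (upTo (suc M)) ⟩
    ∑ f (upTo (suc M))
      ≡⟨ cong (λ m → ∑ f (upTo m)) (trans (sym (ℕ.m∸n+n≡m {suc M} {suc s} (ℕ.s≤s (ℕ.≤-trans s≤n n<M)))) refl) ⟩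
    ∑ f (upTo ((suc M ∸ suc s) ℕ.+ suc s))
      ≡⟨ ∑-upTo-extend f (suc s) (suc M ∸ suc s) beyond ⟩
    ∑ f (upTo (suc s))
      ≡⟨ ∑-upTo-cong (suc s) within ⟩
    ∑ (guarded n s) (upTo (suc s))
      ≡⟨ rowSum n s s≤n ⟩
    walks (suc n ∸ s) s ∎
    where
    f : ℕ → ℤ
    f t = if t ≤ᵇ s then guarded n s t else 0ℤ
    beyond : ∀ t → s ℕ.< t → f t ≡ 0ℤ
    beyond t s<t with t ≤ᵇ s in eq
    ... | false = refl
    ... | true  = contradiction (ℕ.≤ᵇ⇒≤ t s (subst T (sym eq) _)) (ℕ.<⇒≱ s<t)
    within : ∀ t → t ℕ.< suc s → f t ≡ guarded n s t
    within t (ℕ.s≤s t≤s) with t ≤ᵇ s | ℕ.≤⇒≤ᵇ t≤s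
    ... | true | _ = refl
    first-row : ∀ t → ∑ (λ la → chainWeight (suc n) s (t ∷ la)) (vecs M n) ≡ f t
    first-row t = begin
      ∑ (λ la → chainWeight (suc n) s (t ∷ la)) (vecs M n)
        ≡⟨ ∑-cong (chainWeight-∷ n s t) (vecs M n) ⟩
      ∑ (λ la → if t ≤ᵇ s then (if t ≤ᵇ n then c * chainWeight n t la else 0ℤ) else 0ℤ) (vecs M n)
        ≡⟨ trans (∑-if (t ≤ᵇ s) _ (vecs M n)) (cong (λ x → if t ≤ᵇ s then x else 0ℤ) (∑-if (t ≤ᵇ n) _ (vecs M n))) ⟩
      (if t ≤ᵇ s then (if t ≤ᵇ n then ∑ (λ la → c * chainWeight n t la) (vecs M n) else 0ℤ) else 0ℤ)
        ≡⟨ cong (λ x → if t ≤ᵇ s then x else 0ℤ) inner ⟩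
      f t ∎
      where
      c = (q ^ t * q ^ t) * block (suc n) t (s ∸ t)
      inner : (if t ≤ᵇ n then ∑ (λ la → c * chainWeight n t la) (vecs M n) else 0ℤ) ≡ guarded n s t
      inner with t ≤ᵇ n in eq
      ... | false = refl
      ... | true  = trans (∑-*ˡ c (chainWeight n t) (vecs M n))
        (cong (c *_) (chainSum M n t (ℕ.<⇒≤ n<M) (ℕ.≤ᵇ⇒≤ t n (subst T (sym eq) _))))

-- Summation over arrow sets

All-sublists : {A : Set} {P : A → Set} {xs : List A} → All P xs → All (All P) (sublists xs)
All-sublists []         = [] ∷ []
All-sublists (px ∷ pxs) = All.++⁺ (All-sublists pxs) (All.map⁺ (All.map (px ∷_) (All-sublists pxs)))

∑-sublists-cong : {A : Set} {P : A → Set} {f g : List A → ℤ} {xs : List A} → All P xs →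
  (∀ as → All P as → f as ≡ g as) → ∑ f (sublists xs) ≡ ∑ g (sublists xs)
∑-sublists-cong pxs e = ∑-cong-All (All.map (λ {as} → e as) (All-sublists pxs))

∑-sublists-∷ : {A : Set} (f : List A → ℤ) (x : A) (xs : List A) →
  ∑ f (sublists (x ∷ xs)) ≡ ∑ f (sublists xs) + ∑ (λ as → f (x ∷ as)) (sublists xs)
∑-sublists-∷ f x xs = trans (∑-++ f (sublists xs) _) (cong (λ t → ∑ f (sublists xs) + t) (∑-map f (x ∷_) (sublists xs)))

∑-sublists-++ : {A : Set} (f : List A → ℤ) (xs ys : List A) →
  ∑ f (sublists (xs ++ ys)) ≡ ∑ (λ as → ∑ (λ bs → f (as ++ bs)) (sublists ys)) (sublists xs)
∑-sublists-++ f []       ys = sym (ℤ.+-identityʳ _)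
∑-sublists-++ f (x ∷ xs) ys = trans (∑-sublists-∷ f x (xs ++ ys))
  (trans (cong₂ _+_ (∑-sublists-++ f xs ys) (∑-sublists-++ (λ as → f (x ∷ as)) xs ys))
    (sym (∑-sublists-∷ (λ as → ∑ (λ bs → f (as ++ bs)) (sublists ys)) x xs)))

-- Sublists keep the order of their list, so a permutation also reorders the sublists; this is why
-- the summand has to be invariant. Under a swap, the sublists with just one of the two elements
-- change places and those with both are reordered.
∑-sublists-↭ : {A : Set} (f : List A → ℤ) → (∀ {as bs} → as ↭ bs → f as ≡ f bs) →
  {xs ys : List A} → xs ↭ ys → ∑ f (sublists xs) ≡ ∑ f (sublists ys)
∑-sublists-↭ f inv ↭.refl = refl
∑-sublists-↭ f inv {x ∷ xs} {_ ∷ ys} (↭.prep x p) = trans (∑-sublists-∷ f x xs)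
  (trans (cong₂ _+_ (∑-sublists-↭ f inv p) (∑-sublists-↭ (λ as → f (x ∷ as)) (λ r → inv (↭.prep x r)) p))
    (sym (∑-sublists-∷ f x ys)))
∑-sublists-↭ f inv {x ∷ y ∷ xs} {_ ∷ _ ∷ ys} (↭.swap x y p) = begin
  ∑ f (sublists (x ∷ y ∷ xs))
    ≡⟨ expand x y xs ⟩
  (∑ f (sublists xs) + ∑ (f ∘ (y ∷_)) (sublists xs)) + (∑ (f ∘ (x ∷_)) (sublists xs) + ∑ (λ as → f (x ∷ y ∷ as)) (sublists xs))
    ≡⟨ cong₂ _+_ (cong₂ _+_ (∑-sublists-↭ f inv p) (∑-sublists-↭ (f ∘ (y ∷_)) (λ r → inv (↭.prep y r)) p))
         (cong₂ _+_ (∑-sublists-↭ (f ∘ (x ∷_)) (λ r → inv (↭.prep x r)) p)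
           (trans (∑-sublists-↭ (λ as → f (x ∷ y ∷ as)) (λ r → inv (↭.prep x (↭.prep y r))) p) (∑-cong (λ as → inv (↭.swap x y ↭.refl)) (sublists ys)))) ⟩
  (∑ f (sublists ys) + ∑ (f ∘ (y ∷_)) (sublists ys)) + (∑ (f ∘ (x ∷_)) (sublists ys) + ∑ (λ as → f (y ∷ x ∷ as)) (sublists ys))
    ≡⟨ exchange (∑ f (sublists ys)) (∑ (f ∘ (y ∷_)) (sublists ys)) (∑ (f ∘ (x ∷_)) (sublists ys)) (∑ (λ as → f (y ∷ x ∷ as)) (sublists ys)) ⟩
  (∑ f (sublists ys) + ∑ (f ∘ (x ∷_)) (sublists ys)) + (∑ (f ∘ (y ∷_)) (sublists ys) + ∑ (λ as → f (y ∷ x ∷ as)) (sublists ys))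
    ≡⟨ expand y x ys ⟨
  ∑ f (sublists (y ∷ x ∷ ys)) ∎
  where
  open ≡-Reasoning
  expand : ∀ x y xs → ∑ f (sublists (x ∷ y ∷ xs)) ≡
    (∑ f (sublists xs) + ∑ (f ∘ (y ∷_)) (sublists xs)) + (∑ (f ∘ (x ∷_)) (sublists xs) + ∑ (λ as → f (x ∷ y ∷ as)) (sublists xs))
  expand x y xs = trans (∑-sublists-∷ f x (y ∷ xs)) (cong₂ _+_ (∑-sublists-∷ f y xs) (∑-sublists-∷ (f ∘ (x ∷_)) y xs))
  exchange : ∀ a b c d → (a + b) + (c + d) ≡ (a + c) + (b + d)
  exchange = solve-∀
∑-sublists-↭ f inv (↭.trans p r) = trans (∑-sublists-↭ f inv p) (∑-sublists-↭ f inv r)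

count-↭ : {A : Set} (p : A → Bool) {xs ys : List A} → xs ↭ ys → count p xs ≡ count p ys
count-↭ p ↭.refl = refl
count-↭ p (↭.prep x r) = trans (count-∷ p x _) (trans (cong (indicator (p x) ℕ.+_) (count-↭ p r)) (sym (count-∷ p x _)))
count-↭ p {xs = _ ∷ _ ∷ xs} {ys = _ ∷ _ ∷ ys} (↭.swap x y r) = begin
  count p (x ∷ y ∷ xs)                                    ≡⟨ expand x y xs ⟩
  indicator (p x) ℕ.+ (indicator (p y) ℕ.+ count p xs)    ≡⟨ ℕ.+-assoc (indicator (p x)) (indicator (p y)) _ ⟨
  indicator (p x) ℕ.+ indicator (p y) ℕ.+ count p xs      ≡⟨ cong₂ ℕ._+_ (ℕ.+-comm (indicator (p x)) (indicator (p y))) (count-↭ p r) ⟩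
  indicator (p y) ℕ.+ indicator (p x) ℕ.+ count p ys      ≡⟨ ℕ.+-assoc (indicator (p y)) (indicator (p x)) _ ⟩
  indicator (p y) ℕ.+ (indicator (p x) ℕ.+ count p ys)    ≡⟨ expand y x ys ⟨
  count p (y ∷ x ∷ ys)                                    ∎
  where
  open ≡-Reasoning
  expand : ∀ x y xs → count p (x ∷ y ∷ xs) ≡ indicator (p x) ℕ.+ (indicator (p y) ℕ.+ count p xs)
  expand x y xs = trans (count-∷ p x (y ∷ xs)) (cong (indicator (p x) ℕ.+_) (count-∷ p y xs))
count-↭ p (↭.trans r s) = trans (count-↭ p r) (count-↭ p s)

-- Column multiplicities are compared only if the row has a corner. Otherwise column
-- `suc (b (suc i))` may belong to an earlier block, and the multiplicities may differ.
rowOK-cong : ∀ b i as bs →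
  multiplicity (horiz , suc i) as ≡ multiplicity (horiz , suc i) bs →
  (b (suc i) < b i → multiplicity (vert , suc (b (suc i))) as ≡ multiplicity (vert , suc (b (suc i))) bs) →
  rowOK b i as ≡ rowOK b i bs
rowOK-cong b i as bs h v with b (suc i) <ᵇ b i | ℕ.<ᵇ-reflects-< (b (suc i)) (b i)
... | false | _       = refl
... | true  | ofʸ b<b = cong₂ (λ m n → m ℕ.+ n ≤ᵇ 1) h (v b<b)

rowsOK-↭ : ∀ b i m {as bs} → as ↭ bs → rowsOK b i m as ≡ rowsOK b i m bs
rowsOK-↭ b i zero    p = refl
rowsOK-↭ b i (suc m) {as} {bs} p = cong₂ _∧_
  (rowOK-cong b i as bs (count-↭ (sameArrow (horiz , suc i)) p) (λ _ → count-↭ (sameArrow (vert , suc (b (suc i)))) p))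
  (rowsOK-↭ b (suc i) m p)

count-none : {A : Set} (p : A → Bool) {xs : List A} → All (λ x → p x ≡ false) xs → count p xs ≡ 0
count-none p []             = refl
count-none p {x ∷ xs} (e ∷ es) = trans (count-∷ p x xs) (cong₂ (λ t n → indicator t ℕ.+ n) e (count-none p es))

-- Arrow positions grouped into blocks along the boundary

module _ (b : ℕ → ℕ) where

  blockSlots : ℕ → List Arrow
  blockSlots i = (horiz , suc i) ∷ map (vert ,_) (from (suc (b (suc i))) (b i ∸ b (suc i)))

  slots : ℕ → ℕ → List Arrow
  slots i zero    = []
  slots i (suc m) = blockSlots i ++ slots (suc i) m

  -- Regrouping the arrow positions along the boundary path puts the two arrows of each corner in one block.
  slots-↭ : ∀ k → (∀ i → i < k → b (suc i) ≤ b i) → b k ≡ 0 → ∀ i m → i ℕ.+ m ≡ k →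
    map (horiz ,_) (from (suc i) m) ++ map (vert ,_) (from 1 (b i)) ↭ slots i m
  slots-↭ k desc b≡0 i zero eq =
    ↭-reflexive (cong (λ n → map (vert ,_) (from 1 n)) (trans (cong b (trans (sym (ℕ.+-identityʳ i)) eq)) b≡0))
  slots-↭ k desc b≡0 i (suc m) eq = ↭.prep (horiz , suc i)
    (↭.trans (↭-reflexive (trans (cong (H ++_) columns-split) (sym (++-assoc H V₁ V₂))))
      (↭.trans (++-comm (H ++ V₁) V₂) (++⁺ˡ V₂ (slots-↭ k desc b≡0 (suc i) m (trans (sym (ℕ.+-suc i m)) eq)))))
    where
    i<k : i < k
    i<k = subst (i <_) eq (ℕ.m<m+n i (s≤s z≤n))
    H  = map (horiz ,_) (from (2 ℕ.+ i) m)
    V₁ = map (vert ,_) (from 1 (b (suc i)))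
    V₂ = map (vert ,_) (from (suc (b (suc i))) (b i ∸ b (suc i)))
    columns-split : map (vert ,_) (from 1 (b i)) ≡ V₁ ++ V₂
    columns-split = trans (cong (map (vert ,_)) (trans (cong (from 1) (sym (ℕ.m+[n∸m]≡n (desc i i<k)))) (from-++ 1 (b (suc i)) (b i ∸ b (suc i)))))
      (map-++ (vert ,_) (from 1 (b (suc i))) _)

  -- Follow the boundary of λ down from the top right: at the end of row i it stands at column
  -- `b i`. The rows and columns already passed are `Earlier i`, those still ahead `Later i`.
  Later Earlier : ℕ → Arrow → Set
  Later   i (horiz , r) = i < r
  Later   i (vert  , j) = j ≤ b i
  Earlier i (horiz , r) = r ≤ i
  Earlier i (vert  , j) = b i < j

  module Blocks (k : ℕ) (mono : ∀ {i j} → i ≤ j → j ≤ k → b j ≤ b i) where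

    All-block : {P : Arrow → Set} (i : ℕ) → i < k → P (horiz , suc i) →
      (∀ j → b (suc i) ≤ j → j < b i → P (vert , suc j)) → All P (blockSlots i)
    All-block i i<k ph pv = ph ∷ All.map⁺ (All-from _ _ λ { (suc j) (s≤s b≤j) (s≤s j<) →
      pv j b≤j (ℕ.≤-trans j< (ℕ.≤-reflexive (ℕ.m+[n∸m]≡n (mono (ℕ.n≤1+n i) i<k)))) })

    Later-weaken : ∀ i → i < k → ∀ {a} → Later (suc i) a → Later i a
    Later-weaken i i<k {horiz , r} i<r = ℕ.<⇒≤ i<r
    Later-weaken i i<k {vert , j}  j≤b = ℕ.≤-trans j≤b (mono (ℕ.n≤1+n i) i<k)

    block-earlier : ∀ i → i < k → All (Earlier (suc i)) (blockSlots i)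
    block-earlier i i<k = All-block i i<k ℕ.≤-refl (λ j b≤j _ → s≤s b≤j)

    slots-later : ∀ i m → i ℕ.+ m ≡ k → All (Later i) (slots i m)
    slots-later i zero    eq = []
    slots-later i (suc m) eq = All.++⁺ (All-block i i<k ℕ.≤-refl (λ j _ j<b → j<b))
      (All.map (Later-weaken i i<k) (slots-later (suc i) m (trans (sym (ℕ.+-suc i m)) eq)))
      where
      i<k : i < k
      i<k = subst (i <_) eq (ℕ.m<m+n i (s≤s z≤n))

    horiz-absent : ∀ {i as} → All (λ a → a ≢ (horiz , i)) as → multiplicity (horiz , i) as ≡ 0
    horiz-absent {i} = count-none (sameArrow (horiz , i)) ∘ All.map λ
      { {horiz , r} ne → reflects-false (≡ᵇ-reflects-≡ i r) (λ { refl → ne refl })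
      ; {vert  , r} ne → refl }

    vert-absent : ∀ {j as} → All (λ a → a ≢ (vert , j)) as → multiplicity (vert , j) as ≡ 0
    vert-absent {j} = count-none (sameArrow (vert , j)) ∘ All.map λ
      { {horiz , r} ne → refl
      ; {vert  , r} ne → reflects-false (≡ᵇ-reflects-≡ j r) (λ { refl → ne refl }) }

    multiplicity-++ˡ : ∀ a as bs → multiplicity a bs ≡ 0 → multiplicity a (as ++ bs) ≡ multiplicity a as
    multiplicity-++ˡ a as bs z = trans (count-++ (sameArrow a) as bs) (trans (cong (multiplicity a as ℕ.+_) z) (ℕ.+-identityʳ _))

    multiplicity-++ʳ : ∀ a as bs → multiplicity a as ≡ 0 → multiplicity a (as ++ bs) ≡ multiplicity a bs
    multiplicity-++ʳ a as bs z = trans (count-++ (sameArrow a) as bs) (cong (ℕ._+ multiplicity a bs) z)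

    rowOK-++ : ∀ i as bs → All (Later (suc i)) bs → rowOK b i (as ++ bs) ≡ rowOK b i as
    rowOK-++ i as bs later = rowOK-cong b i (as ++ bs) as
      (multiplicity-++ˡ (horiz , suc i) as bs (horiz-absent (All.map (λ { {horiz , r} l refl → ℕ.<-irrefl refl l }) later)))
      (λ _ → multiplicity-++ˡ (vert , suc (b (suc i))) as bs (vert-absent (All.map (λ { {vert , j} l refl → ℕ.<-irrefl refl l }) later)))

    rowsOK-++ : ∀ i i′ m as bs → i ≤ i′ → i′ ℕ.+ m ≡ k → All (Earlier i) as → rowsOK b i′ m (as ++ bs) ≡ rowsOK b i′ m bs
    rowsOK-++ i i′ zero    as bs i≤i′ eq earlier = refl
    rowsOK-++ i i′ (suc m) as bs i≤i′ eq earlier = cong₂ _∧_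
      (rowOK-cong b i′ (as ++ bs) bs
        (multiplicity-++ʳ (horiz , suc i′) as bs (horiz-absent (All.map (λ { {horiz , r} e refl → ℕ.<⇒≱ e i≤i′ }) earlier)))
        (λ b<b → multiplicity-++ʳ (vert , suc (b (suc i′))) as bs
          (vert-absent (All.map (λ { {vert , j} e refl → ℕ.<⇒≱ e (ℕ.≤-trans b<b (mono i≤i′ i′≤k)) }) earlier))))
      (rowsOK-++ i (suc i′) m as bs (ℕ.m≤n⇒m≤1+n i≤i′) (trans (sym (ℕ.+-suc i′ m)) eq) earlier)
      where
      i′≤k : i′ ≤ k
      i′≤k = subst (i′ ≤_) eq (ℕ.m≤m+n i′ (suc m))

if-* : ∀ c x y → (if c then x * y else 0ℤ) ≡ (if c then x else 0ℤ) * y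
if-* true  x y = refl
if-* false x y = refl

if-∧-* : ∀ c d x y → (if c ∧ d then x * y else 0ℤ) ≡ (if c then x else 0ℤ) * (if d then y else 0ℤ)
if-∧-* true  true  x y = refl
if-∧-* true  false x y = sym (ℤ.*-zeroʳ x)
if-∧-* false d     x y = refl

-- Signed weights of arrow sets

module Weights (q : ℤ) (len : Arrow → ℕ) where
  open ≡-Reasoning

  weight : List Arrow → ℤ
  weight []       = 1ℤ
  weight (a ∷ as) = - q ^ len a * weight as

  weight-monomial : ∀ as → (- 1ℤ) ^ length as * q ^ sum (map len as) ≡ weight as
  weight-monomial []       = refl
  weight-monomial (a ∷ as) = begin
    (- 1ℤ * (- 1ℤ) ^ length as) * q ^ (len a ℕ.+ sum (map len as))
      ≡⟨ cong ((- 1ℤ * (- 1ℤ) ^ length as) *_) (ℤ.^-distribˡ-+-* q (len a) _) ⟩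
    (- 1ℤ * (- 1ℤ) ^ length as) * (q ^ len a * q ^ sum (map len as))
      ≡⟨ rearrange ((- 1ℤ) ^ length as) (q ^ len a) (q ^ sum (map len as)) ⟩
    - q ^ len a * ((- 1ℤ) ^ length as * q ^ sum (map len as))
      ≡⟨ cong (- q ^ len a *_) (weight-monomial as) ⟩
    weight (a ∷ as) ∎
    where
    rearrange : ∀ s x y → (- 1ℤ * s) * (x * y) ≡ - x * (s * y)
    rearrange = solve-∀

  weight-++ : ∀ as bs → weight (as ++ bs) ≡ weight as * weight bs
  weight-++ []       bs = sym (ℤ.*-identityˡ _)
  weight-++ (a ∷ as) bs = trans (cong (- q ^ len a *_) (weight-++ as bs)) (sym (ℤ.*-assoc (- q ^ len a) (weight as) (weight bs)))

  weight-↭ : ∀ {as bs} → as ↭ bs → weight as ≡ weight bs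
  weight-↭ ↭.refl       = refl
  weight-↭ (↭.prep a p)   = cong (- q ^ len a *_) (weight-↭ p)
  weight-↭ {_ ∷ _ ∷ as} {_ ∷ _ ∷ bs} (↭.swap a c p) = trans (cong (λ w → - q ^ len a * (- q ^ len c * w)) (weight-↭ p))
    (exchange (- q ^ len a) (- q ^ len c) (weight bs))
    where
    exchange : ∀ x y z → x * (y * z) ≡ y * (x * z)
    exchange = solve-∀
  weight-↭ (↭.trans p r)  = trans (weight-↭ p) (weight-↭ r)

  ∑-weight-columns : ∀ m t d → (∀ j → t ≤ j → j < t ℕ.+ d → len (vert , suc j) ≡ m ∸ j) →
    ∑ weight (sublists (map (vert ,_) (from (suc t) d))) ≡ columns q m t d
  ∑-weight-columns m t zero    lenV = refl
  ∑-weight-columns m t (suc d) lenV = begin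
    ∑ weight (sublists ((vert , suc t) ∷ vs))
      ≡⟨ ∑-sublists-∷ weight (vert , suc t) vs ⟩
    ∑ weight (sublists vs) + ∑ (λ as → - q ^ len (vert , suc t) * weight as) (sublists vs)
      ≡⟨ cong (λ x → ∑ weight (sublists vs) + x) (∑-*ˡ (- q ^ len (vert , suc t)) weight (sublists vs)) ⟩
    ∑ weight (sublists vs) + - q ^ len (vert , suc t) * ∑ weight (sublists vs)
      ≡⟨ factor (∑ weight (sublists vs)) (q ^ len (vert , suc t)) ⟩
    (1ℤ - q ^ len (vert , suc t)) * ∑ weight (sublists vs)
      ≡⟨ cong₂ (λ e x → (1ℤ - q ^ e) * x) (lenV t ℕ.≤-refl (ℕ.m<m+n t (s≤s z≤n)))
           (∑-weight-columns m (suc t) d (λ j t<j j< → lenV j (ℕ.<⇒≤ t<j) (ℕ.≤-trans j< (ℕ.≤-reflexive (sym (ℕ.+-suc t d)))))) ⟩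
    columns q m t (suc d) ∎
    where
    vs = map (vert ,_) (from (2 ℕ.+ t) d)
    factor : ∀ s y → s + - y * s ≡ (1ℤ - y) * s
    factor = solve-∀

  module Sum (k : ℕ) (b : ℕ → ℕ) (mono : ∀ {i j} → i ≤ j → j ≤ k → b j ≤ b i)
    (lenH : ∀ i m → i ℕ.+ suc m ≡ k → len (horiz , suc i) ≡ suc m ∸ b (suc i))
    (lenV : ∀ i m j → i ℕ.+ suc m ≡ k → b (suc i) ≤ j → j < b i → len (vert , suc j) ≡ suc m ∸ j) where

    open Blocks b k mono

    blockWeight : ℕ → List Arrow → ℤ
    blockWeight i as = if rowOK b i as then weight as else 0ℤ

    blockSum : ∀ i m → i ℕ.+ suc m ≡ k → ∑ (blockWeight i) (sublists (blockSlots b i)) ≡ block q (suc m) (b (suc i)) (b i ∸ b (suc i))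
    blockSum i m eq = go (b i ∸ b (suc i)) refl
      where
      t = b (suc i)
      h v : Arrow
      h = horiz , suc i
      v = vert , suc t
      i<k : i < k
      i<k = subst (i <_) eq (ℕ.m<m+n i (s≤s z≤n))
      t+d≡ : t ℕ.+ (b i ∸ t) ≡ b i
      t+d≡ = ℕ.m+[n∸m]≡n (mono (ℕ.n≤1+n i) i<k)
      go : ∀ d → b i ∸ t ≡ d → ∑ (blockWeight i) (sublists (h ∷ map (vert ,_) (from (suc t) d))) ≡ block q (suc m) t d
      go zero d≡ = begin
        blockWeight i [] + (blockWeight i (h ∷ []) + 0ℤ)
          ≡⟨ cong₂ (λ x y → x + (y + 0ℤ)) (free []) (free (h ∷ [])) ⟩
        1ℤ + (- q ^ len h * 1ℤ + 0ℤ)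
          ≡⟨ simplify (q ^ len h) ⟩
        1ℤ - q ^ len h
          ≡⟨ cong (λ e → 1ℤ - q ^ e) (lenH i m eq) ⟩
        1ℤ - q ^ (suc m ∸ t) ∎
        where
        free : ∀ as → blockWeight i as ≡ weight as
        free as = cong (λ x → if x then weight as else 0ℤ)
          (reflects-true (rowOK-reflects b as i) (λ b<b → contradiction (ℕ.m∸n≡0⇒m≤n {b i} {t} d≡) (ℕ.<⇒≱ b<b)))
        simplify : ∀ y → 1ℤ + (- y * 1ℤ + 0ℤ) ≡ 1ℤ - y
        simplify = solve-∀
      go (suc d) d≡ = begin
        ∑ (blockWeight i) (sublists (h ∷ v ∷ vs))
          -- The four summands are the choices for the row and the corner column: neither, column,
          -- row, both. The remaining columns `vs` are free and contribute the common factor `Σ`.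
          ≡⟨ ∑-sublists-++ (blockWeight i) (h ∷ v ∷ []) vs ⟩
        S [] + (S (v ∷ []) + (S (h ∷ []) + (S (h ∷ v ∷ []) + 0ℤ)))
          ≡⟨ cong₂ _+_ (separate [] (allowed [] z≤n))
               (cong₂ _+_ (separate (v ∷ []) (allowed (v ∷ []) (ℕ.≤-reflexive only-v)))
                 (cong₂ _+_ (separate (h ∷ []) (allowed (h ∷ []) (ℕ.≤-reflexive only-h)))
                   (cong (_+ 0ℤ) (separate (h ∷ v ∷ []) forbidden)))) ⟩
        1ℤ * Σ + (- q ^ len v * 1ℤ * Σ + (- q ^ len h * 1ℤ * Σ + (0ℤ * Σ + 0ℤ)))
          ≡⟨ collect Σ (q ^ len v) (q ^ len h) ⟩
        (1ℤ - q ^ len v - q ^ len h) * Σ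
          ≡⟨ cong₂ (λ e f → (1ℤ - q ^ e - q ^ f) * Σ) (lenV i m t eq ℕ.≤-refl t<b) (lenH i m eq) ⟩
        (1ℤ - q ^ (suc m ∸ t) - q ^ (suc m ∸ t)) * Σ
          ≡⟨ cong ((1ℤ - q ^ (suc m ∸ t) - q ^ (suc m ∸ t)) *_) (∑-weight-columns (suc m) (suc t) d
               (λ j t<j j< → lenV i m j eq (ℕ.<⇒≤ t<j) (ℕ.≤-trans j< (ℕ.≤-reflexive end)))) ⟩
        block q (suc m) t (suc d) ∎
        where
        vs = map (vert ,_) (from (2 ℕ.+ t) d)
        Σ = ∑ weight (sublists vs)
        S : List Arrow → ℤ
        S as = ∑ (λ bs → blockWeight i (as ++ bs)) (sublists vs)
        end : suc t ℕ.+ d ≡ b i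
        end = trans (sym (ℕ.+-suc t d)) (trans (cong (t ℕ.+_) (sym d≡)) t+d≡)
        t<b : t < b i
        t<b = ℕ.≤-trans (s≤s (ℕ.m≤m+n t d)) (ℕ.≤-reflexive end)
        other : All (λ a → a ≢ h × a ≢ v) vs
        other = All.map⁺ (All-from _ _ λ j t<j _ → (λ ()) , λ { refl → ℕ.<-irrefl refl t<j })
        separate : ∀ as {w} → blockWeight i as ≡ w → S as ≡ w * Σ
        separate as {w} e = begin
          S as
            ≡⟨ ∑-sublists-cong other (λ bs ne → trans
                 (cong₂ (λ x y → if x then y else 0ℤ)
                   (rowOK-cong b i (as ++ bs) as (multiplicity-++ˡ h as bs (horiz-absent (All.map proj₁ ne)))
                     (λ _ → multiplicity-++ˡ v as bs (vert-absent (All.map proj₂ ne))))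
                   (weight-++ as bs))
                 (if-* (rowOK b i as) (weight as) (weight bs))) ⟩
          ∑ (λ bs → blockWeight i as * weight bs) (sublists vs)
            ≡⟨ ∑-*ˡ (blockWeight i as) weight (sublists vs) ⟩
          blockWeight i as * Σ
            ≡⟨ cong (_* Σ) e ⟩
          w * Σ ∎
        allowed : ∀ as → multiplicity h as ℕ.+ multiplicity v as ≤ 1 → blockWeight i as ≡ weight as
        allowed as ≤1 = cong (λ x → if x then weight as else 0ℤ) (reflects-true (rowOK-reflects b as i) (λ _ → ≤1))
        same : ∀ n → indicator (n ℕ.≡ᵇ n) ≡ 1
        same n = cong indicator (reflects-true (≡ᵇ-reflects-≡ n n) refl)
        only-v : multiplicity h (v ∷ []) ℕ.+ multiplicity v (v ∷ []) ≡ 1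
        only-v = trans (count-∷ (sameArrow v) v []) (trans (ℕ.+-identityʳ _) (same t))
        only-h : multiplicity h (h ∷ []) ℕ.+ multiplicity v (h ∷ []) ≡ 1
        only-h = trans (ℕ.+-identityʳ _) (trans (count-∷ (sameArrow h) h []) (trans (ℕ.+-identityʳ _) (same i)))
        both : multiplicity h (h ∷ v ∷ []) ℕ.+ multiplicity v (h ∷ v ∷ []) ≡ 2
        both = cong₂ ℕ._+_ (trans (count-∷ (sameArrow h) h (v ∷ [])) (trans (ℕ.+-identityʳ _) (same i))) only-v
        forbidden : blockWeight i (h ∷ v ∷ []) ≡ 0ℤ
        forbidden = cong (λ x → if x then weight (h ∷ v ∷ []) else 0ℤ)
          (reflects-false (rowOK-reflects b (h ∷ v ∷ []) i) (λ ok → ℕ.<⇒≱ (ℕ.≤-reflexive (sym both)) (ok t<b)))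
        collect : ∀ Σ x y → 1ℤ * Σ + (- x * 1ℤ * Σ + (- y * 1ℤ * Σ + (0ℤ * Σ + 0ℤ))) ≡ (1ℤ - x - y) * Σ
        collect = solve-∀

    rowsWeight : ℕ → ℕ → List Arrow → ℤ
    rowsWeight i m as = if rowsOK b i m as then weight as else 0ℤ

    -- The first block holds only passed arrows and the later blocks only arrows ahead, so validity
    -- is the conjunction of a condition on each part and the double sum is a product.
    rowsSum : ∀ i m → i ℕ.+ m ≡ k → ∑ (rowsWeight i m) (sublists (slots b i m)) ≡ rows q b i m
    rowsSum i zero    eq = refl
    rowsSum i (suc m) eq = begin
      ∑ (rowsWeight i (suc m)) (sublists (blockSlots b i ++ slots b (suc i) m))
        ≡⟨ ∑-sublists-++ (rowsWeight i (suc m)) (blockSlots b i) (slots b (suc i) m) ⟩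
      ∑ (λ as → ∑ (λ bs → rowsWeight i (suc m) (as ++ bs)) (sublists (slots b (suc i) m))) (sublists (blockSlots b i))
        ≡⟨ ∑-sublists-cong (block-earlier i i<k) (λ as earlier → trans
             (∑-sublists-cong (slots-later (suc i) m eq′) (λ bs later → separate as bs earlier later))
             (∑-*ˡ (blockWeight i as) (rowsWeight (suc i) m) (sublists (slots b (suc i) m)))) ⟩
      ∑ (λ as → blockWeight i as * R) (sublists (blockSlots b i))
        ≡⟨ ∑-cong (λ as → ℤ.*-comm (blockWeight i as) R) (sublists (blockSlots b i)) ⟩
      ∑ (λ as → R * blockWeight i as) (sublists (blockSlots b i))
        ≡⟨ ∑-*ˡ R (blockWeight i) (sublists (blockSlots b i)) ⟩
      R * ∑ (blockWeight i) (sublists (blockSlots b i))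
        ≡⟨ ℤ.*-comm R _ ⟩
      ∑ (blockWeight i) (sublists (blockSlots b i)) * R
        ≡⟨ cong₂ _*_ (blockSum i m eq) (rowsSum (suc i) m eq′) ⟩
      rows q b i (suc m) ∎
      where
      R = ∑ (rowsWeight (suc i) m) (sublists (slots b (suc i) m))
      eq′ : suc i ℕ.+ m ≡ k
      eq′ = trans (sym (ℕ.+-suc i m)) eq
      i<k : i < k
      i<k = subst (i <_) eq (ℕ.m<m+n i (s≤s z≤n))
      separate : ∀ as bs → All (Earlier b (suc i)) as → All (Later b (suc i)) bs →
        rowsWeight i (suc m) (as ++ bs) ≡ blockWeight i as * rowsWeight (suc i) m bs
      separate as bs earlier later = trans
        (cong₂ (λ x y → if x then y else 0ℤ)
          (cong₂ _∧_ (rowOK-++ i as bs later) (rowsOK-++ (suc i) (suc i) m as bs ℕ.≤-refl eq′ earlier))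
          (weight-++ as bs))
        (if-∧-* (rowOK b i as) (rowsOK b (suc i) m bs) (weight as) (weight bs))

    All-slots : {P : Arrow → Set} → (∀ i → i < k → P (horiz , suc i)) →
      (∀ i → i < k → ∀ j → b (suc i) ≤ j → j < b i → P (vert , suc j)) →
      ∀ i m → i ℕ.+ m ≡ k → All P (slots b i m)
    All-slots ph pv i zero    eq = []
    All-slots ph pv i (suc m) eq = All.++⁺ (All-block i i<k (ph i i<k) (pv i i<k))
      (All-slots ph pv (suc i) m (trans (sym (ℕ.+-suc i m)) eq))
      where
      i<k : i < k
      i<k = subst (i <_) eq (ℕ.m<m+n i (s≤s z≤n))

-- Assembly for one partition, and over all partitions

module _ (q : ℤ) (k : ℕ) (la : List ℕ) (desc : Descending k (boundary k la)) where
  open Geometry k la desc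
  open Weights q (arrowLength k la)
  open Sum k b b-mono horiz-length vert-length
  open ≡-Reasoning

  b-end : b k ≡ 0
  b-end = ℕ.n≤0⇒n≡0 (ℕ.+-cancelʳ-≤ k (b k) 0 (b-bound k ℕ.≤-refl))

  arrowSlots-↭ : arrowSlots k ↭ slots b 0 k
  arrowSlots-↭ = ↭.trans
    (↭-reflexive (cong (λ xs → map (horiz ,_) xs ++ map (vert ,_) xs) (range1≡from k)))
    (slots-↭ b k (λ i i<k → proj₁ (desc i i<k)) b-end 0 k refl)

  -- λ lies in δ_{k-1}, so the antidiagonal cells of δ_k, one in each row and column, stay outside
  -- it. The proof goes through `slots` because `vert-length` needs to know in which block a column
  -- lies.
  arrows-positive : All (λ a → 1 ≤ arrowLength k la a) (arrowSlots k)
  arrows-positive = All-resp-↭ (↭-sym arrowSlots-↭) (All-slots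
    (λ i i<k → subst (1 ≤_) (sym (horiz-length i (k ∸ suc i) (rest i<k)))
      (ℕ.m<n⇒0<n∸m (fits i<k (b (suc i)) (proj₂ (desc i i<k)))))
    (λ i i<k j b≤j j<b → subst (1 ≤_) (sym (vert-length i (k ∸ suc i) j (rest i<k) b≤j j<b))
      (ℕ.m<n⇒0<n∸m (fits i<k j (ℕ.≤-trans (ℕ.≤-reflexive (ℕ.+-suc j i)) (ℕ.≤-trans (ℕ.+-monoˡ-≤ i j<b) (b-bound i (ℕ.<⇒≤ i<k)))))))
    0 k refl)
    where
    rest : ∀ {i} → i < k → i ℕ.+ suc (k ∸ suc i) ≡ k
    rest {i} i<k = trans (ℕ.+-suc i _) (ℕ.m+[n∸m]≡n i<k)
    fits : ∀ {i} → i < k → ∀ j → j ℕ.+ suc i ≤ k → j < suc (k ∸ suc i)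
    fits i<k j h = s≤s (ℕ.m+n≤o⇒m≤o∸n j h)

  arrowSum : ∑ (λ as → if validArrows k la as then monomial q (wt k (la , as)) else 0ℤ) (sublists (arrowSlots k))
    ≡ partitionWeight q k k la
  arrowSum = begin
    ∑ (λ as → if validArrows k la as then monomial q (wt k (la , as)) else 0ℤ) (sublists (arrowSlots k))
      ≡⟨ ∑-sublists-cong arrows-positive (λ as positive → trans
           (cong₂ (λ c x → if c then x else 0ℤ) (validArrows≡rowsOK as positive) (monomial-split as))
           (*-if Q (rowsOK b 0 k as) (weight as))) ⟩
    ∑ (λ as → Q * rowsWeight 0 k as) (sublists (arrowSlots k))
      ≡⟨ ∑-*ˡ Q (rowsWeight 0 k) (sublists (arrowSlots k)) ⟩
    Q * ∑ (rowsWeight 0 k) (sublists (arrowSlots k))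
      ≡⟨ cong (Q *_) (∑-sublists-↭ (rowsWeight 0 k)
           (λ p → cong₂ (λ c x → if c then x else 0ℤ) (rowsOK-↭ b 0 k p) (weight-↭ p)) arrowSlots-↭) ⟩
    Q * ∑ (rowsWeight 0 k) (sublists (slots b 0 k))
      ≡⟨ cong (Q *_) (rowsSum 0 k refl) ⟩
    Q * rows q b 0 k ∎
    where
    Q = q ^ size la * q ^ size la
    monomial-split : ∀ as → monomial q (wt k (la , as)) ≡ Q * weight as
    monomial-split as = begin
      s * q ^ (2 ℕ.* size la ℕ.+ totalLength k la as)
        ≡⟨ cong (s *_) (ℤ.^-distribˡ-+-* q (2 ℕ.* size la) (totalLength k la as)) ⟩
      s * (q ^ (2 ℕ.* size la) * q ^ totalLength k la as)
        ≡⟨ cong (λ x → s * (x * q ^ totalLength k la as))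
             (trans (cong (λ n → q ^ (size la ℕ.+ n)) (ℕ.+-identityʳ (size la))) (ℤ.^-distribˡ-+-* q (size la) (size la))) ⟩
      s * (Q * q ^ totalLength k la as)
        ≡⟨ rearrange s Q (q ^ totalLength k la as) ⟩
      Q * (s * q ^ totalLength k la as)
        ≡⟨ cong (Q *_) (weight-monomial as) ⟩
      Q * weight as ∎
      where
      s = (- 1ℤ) ^ length as
      rearrange : ∀ x y z → x * (y * z) ≡ y * (x * z)
      rearrange = solve-∀

All-vecs-length : ∀ M n → All (λ la → length la ≡ n) (vecs M n)
All-vecs-length M zero    = refl ∷ []
All-vecs-length M (suc n) = All.concat⁺ (All.map⁺ (All.universal
  (λ x → All.map⁺ (All.map (cong suc) (All-vecs-length M n))) (upTo (suc M))))

eval-lhs : ∀ q k → eval q (lhs k) ≡ Paths.walks q 0 k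
eval-lhs q k = begin
  ∑ (monomial q) (map (wt k) (DeltaPlus k))
    ≡⟨ ∑-map (monomial q) (wt k) (DeltaPlus k) ⟩
  ∑ (λ C → monomial q (wt k C)) (DeltaPlus k)
    ≡⟨ ∑-concatMap (λ C → monomial q (wt k C)) configurations (partitionsIn k) ⟩
  ∑ (λ la → ∑ (λ C → monomial q (wt k C)) (configurations la)) (partitionsIn k)
    ≡⟨ ∑-filterᵇ _ (partInDeltaPrev k) (vecs k k) ⟩
  ∑ (λ la → if partInDeltaPrev k la then ∑ (λ C → monomial q (wt k C)) (configurations la) else 0ℤ) (vecs k k)
    ≡⟨ ∑-cong-All (All.map (λ {la} → perPartition la) (All-vecs-length k k)) ⟩
  ∑ (chainWeight q k k) (vecs k k)
    -- All k rows lie beneath a virtual row with k cells, so the height is `k ∸ k`, which puts the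
    -- sum on the diagonal.
    ≡⟨ chainSum q k k k ℕ.≤-refl ℕ.≤-refl ⟩
  Paths.walks q (k ∸ k) k
    ≡⟨ cong (λ h → Paths.walks q h k) (ℕ.n∸n≡0 k) ⟩
  Paths.walks q 0 k ∎
  where
  open ≡-Reasoning
  configurations : List ℕ → List Config
  configurations la = map (la ,_) (filterᵇ (validArrows k la) (sublists (arrowSlots k)))
  perPartition : ∀ la → length la ≡ k →
    (if partInDeltaPrev k la then ∑ (λ C → monomial q (wt k C)) (configurations la) else 0ℤ) ≡ chainWeight q k k la
  perPartition la len = trans
    (cong (λ c → if c then ∑ (λ C → monomial q (wt k C)) (configurations la) else 0ℤ) (partInDeltaPrev≡chain la k len))
    (onChain (chain-reflects (boundary k la) k))
    where
    onChain : ∀ {c} → Reflects (Descending k (boundary k la)) c →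
      (if c then ∑ (λ C → monomial q (wt k C)) (configurations la) else 0ℤ) ≡ (if c then partitionWeight q k k la else 0ℤ)
    onChain (ofⁿ _)    = refl
    onChain (ofʸ desc) = begin
      ∑ (λ C → monomial q (wt k C)) (configurations la)
        ≡⟨ ∑-map (λ C → monomial q (wt k C)) (la ,_) (filterᵇ (validArrows k la) (sublists (arrowSlots k))) ⟩
      ∑ (λ as → monomial q (wt k (la , as))) (filterᵇ (validArrows k la) (sublists (arrowSlots k)))
        ≡⟨ ∑-filterᵇ (λ as → monomial q (wt k (la , as))) (validArrows k la) (sublists (arrowSlots k)) ⟩
      ∑ (λ as → if validArrows k la as then monomial q (wt k (la , as)) else 0ℤ) (sublists (arrowSlots k))
        ≡⟨ arrowSum q k la desc ⟩
      partitionWeight q k k la ∎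

theorem3p3 : (k : ℕ) → lhs k ≈ₚ rhs k
theorem3p3 k = eval-injective (lhs k) (rhs k) (λ x → trans (eval-lhs x k) (sym (eval-rhs x k)))
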